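{- The categories $\mathsf{QFF}$ (of first-order Boolean doctrines equipped with a quantifier-free fragment) and $\mathsf{QA}$ (of QA-stratified Boolean doctrines) are equivalent.
   Context: $\mathbb{N}$ contains $0$; $\mathsf{BA}$ is the category of Boolean algebras and Boolean homomorphisms. A Boolean doctrine over a category $\mathsf{C}$ with finite products is a functor $\mathbf{P}\colon\mathsf{C}^{\mathrm{op}}\to\mathsf{BA}$. A Boolean doctrine morphism from $\mathbf{P}\colon\mathsf{C}^{\mathrm{op}}\to\mathsf{BA}$ to $\mathbf{R}\colon\mathsf{D}^{\mathrm{op}}\to\mathsf{BA}$ is a pair $(M,\mathfrak{m})$ with $M\colon\mathsf{C}\to\mathsf{D}$ a finite-product-preserving functor and $\mathfrak{m}\colon\mathbf{P}\to\mathbf{R}\circ M^{\mathrm{op}}$ a natural transformation. A Boolean doctrine $\mathbf{P}$ is a first-order Boolean doctrine if (i) for all $X,Y\in\mathsf{C}$ the map $\mathbf{P}(\mathrm{pr}_1)\colon\mathbf{P}(X)\to\mathbf{P}(X\times Y)$ has a right adjoint $(\forall Y)_X$ (as an order-preserving map); and (ii) for every $f\colon X'\to X$ and every $Y$, $\mathbf{P}(f)\circ(\forall Y)_X=(\forall Y)_{X'}\circ\mathbf{P}(f\times\mathrm{id}_Y)$. A first-order Boolean doctrine morphism is a Boolean doctrine morphism $(M,\mathfrak{m})$ between first-order Boolean doctrines with $\mathfrak{m}_X\circ(\forall Y)_X=(\forall M(Y))_{M(X)}\circ\mathfrak{m}_{X\times Y}$ for all $X,Y$. A quantifier-free fragment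 of a first-order Boolean doctrine $\mathbf{P}\colon\mathsf{C}^{\mathrm{op}}\to\mathsf{BA}$ is a subfunctor $\mathbf{P}_0$ of $\mathbf{P}$ (each $\mathbf{P}_0(X)$ a Boolean subalgebra of $\mathbf{P}(X)$, closed under reindexing) such that, for each $X$, $\mathbf{P}(X)=\bigcup_{n\in\mathbb{N}}\mathbf{P}_n(X)$, where, inductively, $\mathbf{P}_{n+1}(X)$ is the Boolean subalgebra of $\mathbf{P}(X)$ generated by the union, over all objects $Y$, of the images of $\mathbf{P}_n(X\times Y)$ under $(\forall Y)_X$. $\mathsf{QFF}$: objects are pairs $(\mathbf{P}_0,\mathbf{P})$ with $\mathbf{P}_0$ a quantifier-free fragment of a first-order Boolean doctrine $\mathbf{P}$ (over any base category); morphisms $(\mathbf{P}_0,\mathbf{P})\to(\mathbf{R}_0,\mathbf{R})$ are first-order Boolean doctrine morphisms $(M,\mathfrak{m})\colon\mathbf{P}\to\mathbf{R}$ that restrict to a Boolean doctrine morphism $\mathbf{P}_0\to\mathbf{R}_0$. QA-one-step Boolean doctrine over $\mathsf{C}$: a componentwise injective natural transformation $i\colon\mathbf{P}_0\hookrightarrow\mathbf{P}_1$ (often regarded as a subset inclusion) between functors $\mathsf{C}^{\mathrm{op}}\to\mathsf{BA}$ such that: (1) for all $X,Y\in\mathsf{C}$ and $\beta\in\mathbf{P}_0(X\times Y)$ there is a (necessarily unique) element $(\forall Y)_X\beta\in\mathbf{P}_1(X)$ such that for all $\alpha\in\mathbf{P}_1(X)$: $\alpha\le(\forall Y)_X\beta$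 iff $\mathbf{P}_1(\mathrm{pr}_1)(\alpha)\le i_{X\times Y}(\beta)$; (2) for every $f\colon X'\to X$ and every $Y$, $\mathbf{P}_1(f)\circ(\forall Y)_X=(\forall Y)_{X'}\circ\mathbf{P}_0(f\times\mathrm{id}_Y)$; (3) for all $X$, the Boolean algebra $\mathbf{P}_1(X)$ is generated by the union over $Y\in\mathsf{C}$ of the images of $(\forall Y)_X\colon\mathbf{P}_0(X\times Y)\to\mathbf{P}_1(X)$. QA-stratified Boolean doctrine over $\mathsf{C}$: a sequence of functors $(\mathbf{P}_n\colon\mathsf{C}^{\mathrm{op}}\to\mathsf{BA})_{n\in\mathbb{N}}$ and QA-one-step Boolean doctrines $(i_n\colon\mathbf{P}_n\hookrightarrow\mathbf{P}_{n+1})_{n\in\mathbb{N}}$, with one-step quantifiers $(\forall Y)_{X,n}\colon\mathbf{P}_n(X\times Y)\to\mathbf{P}_{n+1}(X)$, such that $(i_{n+1})_X\circ(\forall Y)_{X,n}=(\forall Y)_{X,n+1}\circ(i_n)_{X\times Y}$ for all $X,Y,n$. $\mathsf{QA}$: objects are QA-stratified Boolean doctrines (over any base category); a morphism from $(\mathbf{P}_n)_n$ over $\mathsf{C}$ to $(\mathbf{R}_n)_n$ over $\mathsf{D}$ is a pair $(M,(\mathfrak{m}_n)_{n})$ with $M\colon\mathsf{C}\to\mathsf{D}$ a finite-product-preserving functor and $\mathfrak{m}_n\colon\mathbf{P}_n\to\mathbf{R}_n\circ M^{\mathrm{op}}$ natural transformations commuting with the injections $i_n$ and satisfying $(\mathfrak{m}_{n+1})_X\circ(\forall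 Y)_{X,n}=(\forall M(Y))_{M(X),n}\circ(\mathfrak{m}_n)_{X\times Y}$ for all $X,Y,n$. -}

module Defs where

open import Level using (Level; _⊔_; suc)
open import Algebra.Lattice.Bundles using (BooleanAlgebra)
import Algebra.Lattice.Properties.Lattice as LatticeProperties
open import Algebra.Lattice.Morphism.Structures using (IsLatticeHomomorphism)
open import Data.Nat.Base using (ℕ; zero) renaming (suc to sucℕ)
open import Data.Product.Base using (Σ-syntax; ∃-syntax; _×_; _,_; proj₁; proj₂)
open import Function.Bundles using (_⇔_) renaming (module Equivalence to Iff)
open import Function.Definitions using (Injective)
open import Relation.Binary.Bundles using (Poset)
open import Relation.Binary.Core using (Rel)
open import Relation.Binary.Definitions using (Adjoint)
open import Relation.Binary.Morphism.Bundles using (PosetHomomorphism)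
open import Relation.Binary.PropositionalEquality.Core as ≡ using (_≡_)
open import Relation.Binary.Structures using (IsEquivalence)
open import Relation.Unary using (Pred)

private
  variable
    o h e o′ h′ e′ o″ h″ e″ c ℓ p s : Level

record Category (o h e : Level) : Set (suc (o ⊔ h ⊔ e)) where
  infix  4 _≈_ _⇒_
  infixr 9 _∘_
  field
    Obj : Set o
    _⇒_ : Obj → Obj → Set h
    _≈_ : ∀ {A B} → Rel (A ⇒ B) e
    id  : ∀ {A} → A ⇒ A
    _∘_ : ∀ {A B C} → B ⇒ C → A ⇒ B → A ⇒ C

    equiv     : ∀ {A B} → IsEquivalence (_≈_ {A} {B})
    ∘-cong    : ∀ {A B C} {f f′ : B ⇒ C} {g g′ : A ⇒ B} →
                f ≈ f′ → g ≈ g′ → f ∘ g ≈ f′ ∘ g′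
    assoc     : ∀ {A B C D} (f : C ⇒ D) (g : B ⇒ C) (k : A ⇒ B) →
                (f ∘ g) ∘ k ≈ f ∘ (g ∘ k)
    identityˡ : ∀ {A B} (f : A ⇒ B) → id ∘ f ≈ f
    identityʳ : ∀ {A B} (f : A ⇒ B) → f ∘ id ≈ f

  module Equiv {A B} = IsEquivalence (equiv {A} {B})

op : Category o h e → Category o h e
op C = record
  { Obj       = Obj
  ; _⇒_       = λ A B → B ⇒ A
  ; _≈_       = _≈_
  ; id        = id
  ; _∘_       = λ f g → g ∘ f
  ; equiv     = equiv
  ; ∘-cong    = λ p q → ∘-cong q p
  ; assoc     = λ f g k → Equiv.sym (assoc k g f)
  ; identityˡ = identityʳ
  ; identityʳ = identityˡ
  }
  where
  open Category C

record Functor (C : Category o h e) (D : Category o′ h′ e′)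
  : Set (o ⊔ h ⊔ e ⊔ o′ ⊔ h′ ⊔ e′) where
  private
    module C = Category C
    module D = Category D
  field
    F₀     : C.Obj → D.Obj
    F₁     : ∀ {A B} → A C.⇒ B → F₀ A D.⇒ F₀ B
    F-cong : ∀ {A B} {f g : A C.⇒ B} → f C.≈ g → F₁ f D.≈ F₁ g
    F-id   : ∀ {A} → F₁ (C.id {A}) D.≈ D.id
    F-∘    : ∀ {A B E} (f : B C.⇒ E) (g : A C.⇒ B) →
             F₁ (f C.∘ g) D.≈ F₁ f D.∘ F₁ g

opF : {C : Category o h e} {D : Category o′ h′ e′} →
      Functor C D → Functor (op C) (op D)
opF F = record
  { F₀     = F₀
  ; F₁     = F₁
  ; F-cong = F-cong
  ; F-id   = F-id
  ; F-∘    = λ f g → F-∘ g f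
  }
  where
  open Functor F

idF : (C : Category o h e) → Functor C C
idF C = record
  { F₀     = λ X → X
  ; F₁     = λ f → f
  ; F-cong = λ p → p
  ; F-id   = Equiv.refl
  ; F-∘    = λ _ _ → Equiv.refl
  }
  where
  open Category C

infixr 9 _∘F_
_∘F_ : {C : Category o h e} {D : Category o′ h′ e′} {E : Category o″ h″ e″} →
       Functor D E → Functor C D → Functor C E
_∘F_ {E = E} G F = record
  { F₀     = λ X → G.F₀ (F.F₀ X)
  ; F₁     = λ f → G.F₁ (F.F₁ f)
  ; F-cong = λ p → G.F-cong (F.F-cong p)
  ; F-id   = E.Equiv.trans (G.F-cong F.F-id) G.F-id
  ; F-∘    = λ f g → E.Equiv.trans (G.F-cong (F.F-∘ f g)) (G.F-∘ (F.F₁ f) (F.F₁ g))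
  }
  where
  module E = Category E
  module G = Functor G
  module F = Functor F

record NatTrans {C : Category o h e} {D : Category o′ h′ e′} (F G : Functor C D)
  : Set (o ⊔ h ⊔ h′ ⊔ e′) where
  private
    module C = Category C
    module D = Category D
    module F = Functor F
    module G = Functor G
  field
    η       : ∀ X → F.F₀ X D.⇒ G.F₀ X
    natural : ∀ {X Y} (f : X C.⇒ Y) → η Y D.∘ F.F₁ f D.≈ G.F₁ f D.∘ η X

record NatIso {C : Category o h e} {D : Category o′ h′ e′} (F G : Functor C D)
  : Set (o ⊔ h ⊔ h′ ⊔ e′) where
  open Category D using (_≈_; _∘_; id)
  field
    to   : NatTrans F G
    from : NatTrans G F
  private
    module to   = NatTrans to
    module from = NatTrans from
  field
    from∘to : ∀ X → from.η X ∘ to.η X ≈ id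
    to∘from : ∀ X → to.η X ∘ from.η X ≈ id

record CategoryEquivalence (C : Category o h e) (D : Category o′ h′ e′)
  : Set (o ⊔ h ⊔ e ⊔ o′ ⊔ h′ ⊔ e′) where
  field
    F    : Functor C D
    G    : Functor D C
    unit   : NatIso (idF C) (G ∘F F)
    counit : NatIso (F ∘F G) (idF D)

-- Equality of functors: equality on objects and on morphisms.  Since the
-- hom-sets F X ⇒ F Y and G X ⇒ G Y are different types, morphisms are
-- compared after composing with the identities  coe : F X ⇒ G X.

module _ (D : Category o h e) where
  open Category D

  coe : ∀ {A B} → A ≡ B → A ⇒ B
  coe ≡.refl = id

module _ {C : Category o h e} {D : Category o′ h′ e′} where
  private
    module C = Category C
    module D = Category D

  record _≡F_ (F G : Functor C D) : Set (o ⊔ h ⊔ o′ ⊔ e′) where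
    private
      module F = Functor F
      module G = Functor G
    field
      obj≡ : ∀ X → F.F₀ X ≡ G.F₀ X
      hom≈ : ∀ {X Y} (f : X C.⇒ Y) →
             coe D (obj≡ Y) D.∘ F.F₁ f D.≈ G.F₁ f D.∘ coe D (obj≡ X)

module _ (D : Category o h e) where
  open Category D

  id-commutes : ∀ {A B} (f : A ⇒ B) → id ∘ f ≈ f ∘ id
  id-commutes f = Equiv.trans (identityˡ f) (Equiv.sym (identityʳ f))

  private
    sq-sym : ∀ {A B A′ B′} (p : A ≡ A′) (q : B ≡ B′) {f : A ⇒ B} {g : A′ ⇒ B′} →
             coe D q ∘ f ≈ g ∘ coe D p → coe D (≡.sym q) ∘ g ≈ f ∘ coe D (≡.sym p)
    sq-sym ≡.refl ≡.refl {f} {g} eq =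
      Equiv.trans (identityˡ g) (Equiv.trans (Equiv.sym (identityʳ g))
        (Equiv.trans (Equiv.sym eq) (id-commutes f)))

    sq-trans : ∀ {A B A′ B′ A″ B″} (p : A ≡ A′) (q : B ≡ B′)
               (p′ : A′ ≡ A″) (q′ : B′ ≡ B″)
               {f : A ⇒ B} {g : A′ ⇒ B′} {k : A″ ⇒ B″} →
               coe D q ∘ f ≈ g ∘ coe D p → coe D q′ ∘ g ≈ k ∘ coe D p′ →
               coe D (≡.trans q q′) ∘ f ≈ k ∘ coe D (≡.trans p p′)
    sq-trans ≡.refl ≡.refl ≡.refl ≡.refl {f} {g} eq eq′ =
      Equiv.trans eq (Equiv.trans (Equiv.sym (id-commutes g)) eq′)

  ≡F-refl : {C : Category o′ h′ e′} {F : Functor C D} → F ≡F F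
  ≡F-refl {F = F} = record
    { obj≡ = λ _ → ≡.refl
    ; hom≈ = λ f → id-commutes (Functor.F₁ F f)
    }

  ≡F-sym : {C : Category o′ h′ e′} {F G : Functor C D} → F ≡F G → G ≡F F
  ≡F-sym {F = F} {G} eq = record
    { obj≡ = λ X → ≡.sym (obj≡ X)
    ; hom≈ = λ {X} {Y} f → sq-sym (obj≡ X) (obj≡ Y) (hom≈ f)
    }
    where
    open _≡F_ eq

  ≡F-trans : {C : Category o′ h′ e′} {F G H : Functor C D} →
             F ≡F G → G ≡F H → F ≡F H
  ≡F-trans {F = F} {G} {H} eq eq′ = record
    { obj≡ = λ X → ≡.trans (E.obj≡ X) (E′.obj≡ X)
    ; hom≈ = λ {X} {Y} f → sq-trans (E.obj≡ X) (E.obj≡ Y) (E′.obj≡ X) (E′.obj≡ Y)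
                             (E.hom≈ f) (E′.hom≈ f)
    }
    where
    module E  = _≡F_ eq
    module E′ = _≡F_ eq′

  private
    sq-map : {C : Category o′ h′ e′} (F : Functor C D) (let module C = Category C) →
             ∀ {A B A′ B′} (p : A ≡ A′) (q : B ≡ B′) {f : A C.⇒ B} {g : A′ C.⇒ B′} →
             coe C q C.∘ f C.≈ g C.∘ coe C p →
             coe D (≡.cong (Functor.F₀ F) q) ∘ Functor.F₁ F f
               ≈ Functor.F₁ F g ∘ coe D (≡.cong (Functor.F₀ F) p)
    sq-map {C = C} F ≡.refl ≡.refl {f} {g} eq =
      Equiv.trans (identityˡ _) (Equiv.trans
        (F-cong (C.Equiv.trans (C.Equiv.sym (C.identityˡ f)) (C.Equiv.trans eq (C.identityʳ g))))
        (Equiv.sym (identityʳ _)))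
      where
      module C = Category C
      open Functor F

  ≡F-∘ : {B : Category o′ h′ e′} {C : Category o″ h″ e″}
         {G G′ : Functor C D} {F F′ : Functor B C} →
         G ≡F G′ → F ≡F F′ → (G ∘F F) ≡F (G′ ∘F F′)
  ≡F-∘ {G = G} {G′} {F} {F′} eq eq′ = record
    { obj≡ = λ X → ≡.trans (≡.cong G.F₀ (E′.obj≡ X)) (E.obj≡ (F′.F₀ X))
    ; hom≈ = λ {X} {Y} f →
        sq-trans (≡.cong G.F₀ (E′.obj≡ X)) (≡.cong G.F₀ (E′.obj≡ Y))
                 (E.obj≡ (F′.F₀ X)) (E.obj≡ (F′.F₀ Y))
                 (sq-map G (E′.obj≡ X) (E′.obj≡ Y) (E′.hom≈ f)) (E.hom≈ (F′.F₁ f))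
    }
    where
    module G  = Functor G
    module F′ = Functor F′
    module E  = _≡F_ eq
    module E′ = _≡F_ eq′

module _ (C : Category o h e) where
  open Category C

  record IsTerminal (T : Obj) : Set (o ⊔ h ⊔ e) where
    field
      !        : ∀ {A} → A ⇒ T
      !-unique : ∀ {A} (f : A ⇒ T) → f ≈ !

  record IsProduct {X Y P : Obj} (π₁ : P ⇒ X) (π₂ : P ⇒ Y) : Set (o ⊔ h ⊔ e) where
    field
      ⟨_,_⟩    : ∀ {A} → A ⇒ X → A ⇒ Y → A ⇒ P
      project₁ : ∀ {A} (f : A ⇒ X) (g : A ⇒ Y) → π₁ ∘ ⟨ f , g ⟩ ≈ f
      project₂ : ∀ {A} (f : A ⇒ X) (g : A ⇒ Y) → π₂ ∘ ⟨ f , g ⟩ ≈ g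
      unique   : ∀ {A} {f : A ⇒ X} {g : A ⇒ Y} (k : A ⇒ P) →
                 π₁ ∘ k ≈ f → π₂ ∘ k ≈ g → k ≈ ⟨ f , g ⟩

-- Finite products are chosen structure on objects; functors between such
-- categories preserve them only in the sense of universal properties.
record CartesianCategory (o h e : Level) : Set (suc (o ⊔ h ⊔ e)) where
  infixr 7 _⊗_ _⊗₁_
  field
    category : Category o h e

  open Category category public

  field
    𝟙          : Obj
    isTerminal : IsTerminal category 𝟙
    _⊗_        : Obj → Obj → Obj
    pr₁        : ∀ {X Y} → X ⊗ Y ⇒ X
    pr₂        : ∀ {X Y} → X ⊗ Y ⇒ Y
    isProduct  : ∀ {X Y} → IsProduct category (pr₁ {X} {Y}) pr₂

  module Prod {X Y} = IsProduct (isProduct {X} {Y})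

  _⊗₁_ : ∀ {X X′ Y Y′} → X′ ⇒ X → Y′ ⇒ Y → X′ ⊗ Y′ ⇒ X ⊗ Y
  f ⊗₁ g = Prod.⟨ f ∘ pr₁ , g ∘ pr₂ ⟩

record PreservesFiniteProducts {C : Category o h e} {D : Category o′ h′ e′}
  (M : Functor C D) : Set (o ⊔ h ⊔ e ⊔ o′ ⊔ h′ ⊔ e′) where
  private
    module C = Category C
  open Functor M
  field
    terminal : ∀ {T} → IsTerminal C T → IsTerminal D (F₀ T)
    product  : ∀ {X Y P} {π₁ : P C.⇒ X} {π₂ : P C.⇒ Y} →
               IsProduct C π₁ π₂ → IsProduct D (F₁ π₁) (F₁ π₂)

id-preserves : (C : Category o h e) → PreservesFiniteProducts (idF C)
id-preserves C = record { terminal = λ t → t ; product = λ t → t }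

∘-preserves : {C : Category o h e} {D : Category o′ h′ e′} {E : Category o″ h″ e″}
              {N : Functor D E} {M : Functor C D} →
              PreservesFiniteProducts N → PreservesFiniteProducts M →
              PreservesFiniteProducts (N ∘F M)
∘-preserves n m = record
  { terminal = λ t → N.terminal (M.terminal t)
  ; product  = λ t → N.product (M.product t)
  }
  where
  module N = PreservesFiniteProducts n
  module M = PreservesFiniteProducts m

-- The canonical isomorphism  M X × M Y → M (X × Y)  along which the two
-- objects are identified.
module _ (C : CartesianCategory o h e) (D : CartesianCategory o′ h′ e′) where
  private
    module C = CartesianCategory C
    module D = CartesianCategory D

  module _ {M : Functor C.category D.category} (pres : PreservesFiniteProducts M) where
    open Functor M
    open PreservesFiniteProducts pres

    θ : ∀ X Y → F₀ X D.⊗ F₀ Y D.⇒ F₀ (X C.⊗ Y)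
    θ X Y = IsProduct.⟨_,_⟩ (product C.isProduct) D.pr₁ D.pr₂

module _ (B : BooleanAlgebra c ℓ) where
  open BooleanAlgebra B

  -- x ≤ y  is  x ≈ x ∧ y
  poset : Poset c ℓ ℓ
  poset = LatticeProperties.poset lattice

  record IsSubalgebra (S : Pred Carrier p) : Set (c ⊔ ℓ ⊔ p) where
    field
      resp     : ∀ {x y} → x ≈ y → S x → S y
      ∨-closed : ∀ {x y} → S x → S y → S (x ∨ y)
      ∧-closed : ∀ {x y} → S x → S y → S (x ∧ y)
      ¬-closed : ∀ {x} → S x → S (¬ x)
      ⊤-closed : S ⊤
      ⊥-closed : S ⊥

  -- The subalgebra generated by S: the least predicate containing S,
  -- respecting ≈ and closed under the Boolean operations.
  data Generated (S : Pred Carrier p) : Pred Carrier (c ⊔ ℓ ⊔ p) where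
    incl  : ∀ {x} → S x → Generated S x
    resp  : ∀ {x y} → x ≈ y → Generated S x → Generated S y
    _∨ᵍ_  : ∀ {x y} → Generated S x → Generated S y → Generated S (x ∨ y)
    _∧ᵍ_  : ∀ {x y} → Generated S x → Generated S y → Generated S (x ∧ y)
    ¬ᵍ_   : ∀ {x} → Generated S x → Generated S (¬ x)
    ⊤ᵍ    : Generated S ⊤
    ⊥ᵍ    : Generated S ⊥

module _ (A B : BooleanAlgebra c ℓ) where
  private
    module A = BooleanAlgebra A
    module B = BooleanAlgebra B

  record BooleanHom : Set (c ⊔ ℓ) where
    field
      ⟦_⟧                   : A.Carrier → B.Carrier
      isLatticeHomomorphism : IsLatticeHomomorphism A.rawLattice B.rawLattice ⟦_⟧
      ¬-homo                : ∀ x → ⟦ A.¬ x ⟧ B.≈ B.¬ ⟦ x ⟧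
      ⊤-homo                : ⟦ A.⊤ ⟧ B.≈ B.⊤
      ⊥-homo                : ⟦ A.⊥ ⟧ B.≈ B.⊥

    open IsLatticeHomomorphism isLatticeHomomorphism public

open BooleanHom using (⟦_⟧)

BA : (c ℓ : Level) → Category (suc (c ⊔ ℓ)) (c ⊔ ℓ) (c ⊔ ℓ)
BA c ℓ = record
  { Obj       = BooleanAlgebra c ℓ
  ; _⇒_       = BooleanHom
  ; _≈_       = λ {A} {B} f g → ∀ x → _≈_ B (⟦ f ⟧ x) (⟦ g ⟧ x)
  ; id        = λ {A} → record
    { ⟦_⟧ = λ x → x
    ; isLatticeHomomorphism = record
      { isRelHomomorphism = record { cong = λ p → p }
      ; ∧-homo = λ _ _ → refl A
      ; ∨-homo = λ _ _ → refl A
      }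
    ; ¬-homo = λ _ → refl A
    ; ⊤-homo = refl A
    ; ⊥-homo = refl A
    }
  ; _∘_       = λ {A} {B} {C} f g →
    let module f = BooleanHom f
        module g = BooleanHom g
    in record
    { ⟦_⟧ = λ x → f.⟦ g.⟦ x ⟧ ⟧
    ; isLatticeHomomorphism = record
      { isRelHomomorphism = record { cong = λ p → f.⟦⟧-cong (g.⟦⟧-cong p) }
      ; ∧-homo = λ x y → trans C (f.⟦⟧-cong (g.∧-homo x y)) (f.∧-homo _ _)
      ; ∨-homo = λ x y → trans C (f.⟦⟧-cong (g.∨-homo x y)) (f.∨-homo _ _)
      }
    ; ¬-homo = λ x → trans C (f.⟦⟧-cong (g.¬-homo x)) (f.¬-homo _)
    ; ⊤-homo = trans C (f.⟦⟧-cong g.⊤-homo) f.⊤-homo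
    ; ⊥-homo = trans C (f.⟦⟧-cong g.⊥-homo) f.⊥-homo
    }
  ; equiv     = λ {A} {B} → record
    { refl  = λ _ → refl B
    ; sym   = λ p x → sym B (p x)
    ; trans = λ p q x → trans B (p x) (q x)
    }
  ; ∘-cong    = λ {A} {B} {C} {f} {f′} {g} {g′} p q x →
      trans C (BooleanHom.⟦⟧-cong f (q x)) (p (⟦ g′ ⟧ x))
  ; assoc     = λ {A} {B} {C} {D} _ _ _ _ → refl D
  ; identityˡ = λ {A} {B} _ _ → refl B
  ; identityʳ = λ {A} {B} _ _ → refl B
  }
  where
  open BooleanAlgebra using (_≈_; refl; sym; trans)

BooleanDoctrine : CartesianCategory o h e → (c ℓ : Level) → Set (o ⊔ h ⊔ e ⊔ suc (c ⊔ ℓ))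
BooleanDoctrine C c ℓ = Functor (op (CartesianCategory.category C)) (BA c ℓ)

module Doctrine {C : CartesianCategory o h e} (P : BooleanDoctrine C c ℓ) where
  open CartesianCategory C using (Obj) renaming (_⇒_ to _⇒C_)

  module At (X : Obj) where
    open BooleanAlgebra (Functor.F₀ P X) public
    open Poset (poset (Functor.F₀ P X)) public using (_≤_)

  ∣_∣ : Obj → Set c
  ∣ X ∣ = At.Carrier X

  _[_] : ∀ {X Y} → ∣ Y ∣ → X ⇒C Y → ∣ X ∣
  α [ f ] = ⟦ Functor.F₁ P f ⟧ α

module _ (C : CartesianCategory o h e) (D : CartesianCategory o′ h′ e′) where
  private
    module C = CartesianCategory C
    module D = CartesianCategory D

  record BooleanDoctrineMorphism (P : BooleanDoctrine C c ℓ) (R : BooleanDoctrine D c ℓ)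
    : Set (o ⊔ h ⊔ e ⊔ o′ ⊔ h′ ⊔ e′ ⊔ c ⊔ ℓ) where
    field
      M         : Functor C.category D.category
      preserves : PreservesFiniteProducts M
      𝔪         : NatTrans P (R ∘F opF M)

-- Equality of natural transformations 𝔪 : P → R ∘ M^op and 𝔪′ : P → R ∘ M′^op
-- when M and M′ are equal: R (coe _) is the identity R (M′ X) → R (M X).
module _ {C : CartesianCategory o h e} {D : CartesianCategory o′ h′ e′}
         {P : BooleanDoctrine C c ℓ} {R : BooleanDoctrine D c ℓ} where
  private
    module C = CartesianCategory C
    module D = CartesianCategory D
    module P = Doctrine {C = C} P
    module R = Doctrine {C = D} R

  NatEq : {M M′ : Functor C.category D.category} → M ≡F M′ →
          NatTrans P (R ∘F opF M) → NatTrans P (R ∘F opF M′) → Set (o ⊔ c ⊔ ℓ)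
  NatEq {M} {M′} eq 𝔪 𝔪′ = ∀ X (α : P.∣ X ∣) →
    R.At._≈_ (M.F₀ X) (⟦ 𝔪.η X ⟧ α) (⟦ 𝔪′.η X ⟧ α R.[ coe D.category (eq.obj≡ X) ])
    where
    module M  = Functor M
    module 𝔪  = NatTrans 𝔪
    module 𝔪′ = NatTrans 𝔪′
    module eq = _≡F_ eq

  private
    el-sym : ∀ {A B} (p : A ≡ B) {α β} → R.At._≈_ A α (β R.[ coe D.category p ]) →
             R.At._≈_ B β (α R.[ coe D.category (≡.sym p) ])
    el-sym {A} ≡.refl {α} {β} q =
      trans (sym (Functor.F-id R β)) (trans (sym q) (sym (Functor.F-id R α)))
      where
      open R.At A

    el-trans : ∀ {A B E} (p : A ≡ B) (q : B ≡ E) {α β γ} →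
               R.At._≈_ A α (β R.[ coe D.category p ]) →
               R.At._≈_ B β (γ R.[ coe D.category q ]) →
               R.At._≈_ A α (γ R.[ coe D.category (≡.trans p q) ])
    el-trans {A} ≡.refl ≡.refl {α} {β} {γ} s t = trans s (trans (Functor.F-id R β) t)
      where
      open R.At A

  module _ {M : Functor C.category D.category} {𝔪 : NatTrans P (R ∘F opF M)} where
    NatEq-refl : NatEq (≡F-refl D.category) 𝔪 𝔪
    NatEq-refl X α = R.At.sym _ (Functor.F-id R _)

    module _ {M′ : Functor C.category D.category} {𝔪′ : NatTrans P (R ∘F opF M′)} where
      NatEq-sym : (eq : M ≡F M′) → NatEq eq 𝔪 𝔪′ → NatEq (≡F-sym D.category eq) 𝔪′ 𝔪
      NatEq-sym eq q X α = el-sym (_≡F_.obj≡ eq X) (q X α)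

      NatEq-trans : {M″ : Functor C.category D.category} {𝔪″ : NatTrans P (R ∘F opF M″)}
                    (eq : M ≡F M′) (eq′ : M′ ≡F M″) →
                    NatEq eq 𝔪 𝔪′ → NatEq eq′ 𝔪′ 𝔪″ →
                    NatEq (≡F-trans D.category eq eq′) 𝔪 𝔪″
      NatEq-trans eq eq′ q q′ X α =
        el-trans (_≡F_.obj≡ eq X) (_≡F_.obj≡ eq′ X) (q X α) (q′ X α)

idN : {C : CartesianCategory o h e} (P : BooleanDoctrine C c ℓ) →
      NatTrans P (P ∘F opF (idF (CartesianCategory.category C)))
idN {c = c} {ℓ = ℓ} P = record
  { η       = λ _ → Category.id (BA c ℓ)
  ; natural = λ {_} {Y} _ _ → BooleanAlgebra.refl (Functor.F₀ P Y)
  }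

module _ {C : CartesianCategory o h e} {D : CartesianCategory o′ h′ e′}
         {E : CartesianCategory o″ h″ e″}
         {P : BooleanDoctrine C c ℓ} {R : BooleanDoctrine D c ℓ} {S : BooleanDoctrine E c ℓ}
         where
  private
    module C = CartesianCategory C
    module D = CartesianCategory D
    module E = CartesianCategory E
    module P = Doctrine {C = C} P
    module R = Doctrine {C = D} R
    module S = Doctrine {C = E} S

  compN : {N : Functor D.category E.category} {M : Functor C.category D.category} →
          NatTrans R (S ∘F opF N) → NatTrans P (R ∘F opF M) →
          NatTrans P (S ∘F opF (N ∘F M))
  compN {N} {M} 𝔫 𝔪 = record
    { η       = λ X → Category._∘_ (BA c ℓ) (𝔫.η (M.F₀ X)) (𝔪.η X)
    ; natural = λ {X} {Y} f α → S.At.trans _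
        (BooleanHom.⟦⟧-cong (𝔫.η (M.F₀ Y)) (𝔪.natural f α))
        (𝔫.natural (M.F₁ f) (⟦ 𝔪.η X ⟧ α))
    }
    where
    module M = Functor M
    module 𝔫 = NatTrans 𝔫
    module 𝔪 = NatTrans 𝔪

  private
    S-map : {N : Functor D.category E.category} (𝔫 : NatTrans R (S ∘F opF N)) →
            (let module N = Functor N) (let module 𝔫 = NatTrans 𝔫) →
            ∀ {A B Z} (p : A ≡ B) (q : N.F₀ B ≡ Z) {α β γ} →
            R.At._≈_ A α (β R.[ coe D.category p ]) →
            S.At._≈_ (N.F₀ B) (⟦ 𝔫.η B ⟧ β) (γ S.[ coe E.category q ]) →
            S.At._≈_ (N.F₀ A) (⟦ 𝔫.η A ⟧ α) (γ S.[ coe E.category (≡.trans (≡.cong N.F₀ p) q) ])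
    S-map {N} 𝔫 {A} ≡.refl q {α} {β} s t =
      S.At.trans (Functor.F₀ N A)
        (BooleanHom.⟦⟧-cong (NatTrans.η 𝔫 A) (R.At.trans A s (Functor.F-id R β))) t

  NatEq-∘ : {N N′ : Functor D.category E.category} {M M′ : Functor C.category D.category}
            {𝔫 : NatTrans R (S ∘F opF N)} {𝔫′ : NatTrans R (S ∘F opF N′)}
            {𝔪 : NatTrans P (R ∘F opF M)} {𝔪′ : NatTrans P (R ∘F opF M′)}
            (eq : N ≡F N′) (eq′ : M ≡F M′) →
            NatEq {C = D} {D = E} {P = R} {R = S} eq 𝔫 𝔫′ →
            NatEq {C = C} {D = D} {P = P} {R = R} eq′ 𝔪 𝔪′ →
            NatEq {C = C} {D = E} {P = P} {R = S} (≡F-∘ E.category eq eq′)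
              (compN {N = N} {M = M} 𝔫 𝔪) (compN {N = N′} {M = M′} 𝔫′ 𝔪′)
  NatEq-∘ {M′ = M′} {𝔫} {𝔪′ = 𝔪′} eq eq′ q q′ X α =
    S-map 𝔫 (_≡F_.obj≡ eq′ X) (_≡F_.obj≡ eq (Functor.F₀ M′ X)) (q′ X α)
          (q (Functor.F₀ M′ X) (⟦ NatTrans.η 𝔪′ X ⟧ α))

  θ-comp : {N : Functor D.category E.category} {M : Functor C.category D.category}
           (n : PreservesFiniteProducts N) (m : PreservesFiniteProducts M)
           (𝔫 : NatTrans R (S ∘F opF N)) (𝔪 : NatTrans P (R ∘F opF M)) →
           ∀ X Y (β : P.∣ X C.⊗ Y ∣) →
           S.At._≈_ _
             (⟦ NatTrans.η 𝔫 _ ⟧ (⟦ NatTrans.η 𝔪 _ ⟧ β R.[ θ C D m X Y ])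
               S.[ θ D E n (Functor.F₀ M X) (Functor.F₀ M Y) ])
             (⟦ NatTrans.η (compN {N = N} {M = M} 𝔫 𝔪) _ ⟧ β
               S.[ θ C E (∘-preserves n m) X Y ])
  θ-comp {N} {M} n m 𝔫 𝔪 X Y β =
    trans (BooleanHom.⟦⟧-cong (Functor.F₁ S θN) (NatTrans.natural 𝔫 θM _))
      (trans (sym (Functor.F-∘ S θN (N.F₁ θM) _))
        (Functor.F-cong S
          (IsProduct.unique NMprod (N.F₁ θM E.∘ θN)
             (proj (IsProduct.project₁ Mprod D.pr₁ D.pr₂) (IsProduct.project₁ Nprod E.pr₁ E.pr₂))
             (proj (IsProduct.project₂ Mprod D.pr₁ D.pr₂) (IsProduct.project₂ Nprod E.pr₁ E.pr₂)))
          _))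
    where
    module N = Functor N
    module M = Functor M
    open S.At (N.F₀ (M.F₀ X) E.⊗ N.F₀ (M.F₀ Y))
    θM = θ C D m X Y
    θN = θ D E n (M.F₀ X) (M.F₀ Y)
    Mprod  = PreservesFiniteProducts.product m (C.isProduct {X} {Y})
    Nprod  = PreservesFiniteProducts.product n (D.isProduct {M.F₀ X} {M.F₀ Y})
    NMprod = PreservesFiniteProducts.product (∘-preserves n m) (C.isProduct {X} {Y})
    proj : ∀ {A B Q W} {π : A D.⇒ B} {t : Q D.⇒ A} {π′ : Q D.⇒ B}
             {u : W E.⇒ N.F₀ Q} {v : W E.⇒ N.F₀ B} →
           π D.∘ t D.≈ π′ → N.F₁ π′ E.∘ u E.≈ v → N.F₁ π E.∘ (N.F₁ t E.∘ u) E.≈ v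
    proj {π = π} {t} {u = u} s r =
      E.Equiv.trans (E.Equiv.sym (E.assoc _ _ _))
        (E.Equiv.trans (E.∘-cong (E.Equiv.trans (E.Equiv.sym (N.F-∘ π t)) (N.F-cong s))
                                 E.Equiv.refl) r)

module _ {C : CartesianCategory o h e} (P : BooleanDoctrine C c ℓ) where
  private
    module C = CartesianCategory C
    module P = Doctrine {C = C} P

  θ-id : ∀ X Y (β : P.∣ X C.⊗ Y ∣) →
         P.At._≈_ _ β (β P.[ θ C C (id-preserves C.category) X Y ])
  θ-id X Y β = P.At.trans _ (P.At.sym _ (Functor.F-id P β))
    (Functor.F-cong P (C.Prod.unique C.id (C.identityʳ _) (C.identityʳ _)) β)

module _ (C : CartesianCategory o h e) (P : BooleanDoctrine C c ℓ) where
  open CartesianCategory C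
    using (Obj; _⇒_; id; _⊗_; _⊗₁_; pr₁)
  open Doctrine {C = C} P

  record IsFirstOrder : Set (o ⊔ h ⊔ c ⊔ ℓ) where
    field
      forallHom : ∀ X Y → PosetHomomorphism (poset (Functor.F₀ P (X ⊗ Y)))
                                            (poset (Functor.F₀ P X))

    all : ∀ X Y → ∣ X ⊗ Y ∣ → ∣ X ∣
    all X Y = PosetHomomorphism.⟦_⟧ (forallHom X Y)

    field
      adjoint       : ∀ X Y → Adjoint (At._≤_ X) (At._≤_ (X ⊗ Y)) (_[ pr₁ ]) (all X Y)
      beckChevalley : ∀ {X X′} (f : X′ ⇒ X) Y (β : ∣ X ⊗ Y ∣) →
                      At._≈_ X′ (all X Y β [ f ]) (all X′ Y (β [ f ⊗₁ id ]))

  record Subfunctor (p : Level) : Set (o ⊔ h ⊔ c ⊔ ℓ ⊔ suc p) where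
    field
      Member       : ∀ X → Pred ∣ X ∣ p
      isSubalgebra : ∀ X → IsSubalgebra (Functor.F₀ P X) (Member X)
      reindex      : ∀ {X Y} (f : X ⇒ Y) {α} → Member Y α → Member X (α [ f ])

module _ (C : CartesianCategory o h e) (P : BooleanDoctrine C (o ⊔ c) (o ⊔ c))
         (isFO : IsFirstOrder C P) where
  open CartesianCategory C using (Obj; _⊗_)
  open Doctrine {C = C} P
  open IsFirstOrder isFO

  -- layer P₀ n  is  Pₙ, as a family of subsets of the P X.
  layer : (∀ X → Pred ∣ X ∣ (o ⊔ c)) → ℕ → ∀ X → Pred ∣ X ∣ (o ⊔ c)
  layer P₀ zero     X = P₀ X
  layer P₀ (sucℕ n) X = Generated (Functor.F₀ P X)
    λ α → ∃[ Y ] Σ[ β ∈ ∣ X ⊗ Y ∣ ] layer P₀ n (X ⊗ Y) β × At._≈_ X α (all X Y β)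

  record IsQuantifierFreeFragment (P₀ : Subfunctor C P (o ⊔ c)) : Set (o ⊔ c) where
    field
      exhausts : ∀ X (α : ∣ X ∣) → ∃[ n ] layer (Subfunctor.Member P₀) n X α

module _ (C : CartesianCategory o h e) (D : CartesianCategory o′ h′ e′)
         {P : BooleanDoctrine C c ℓ} {R : BooleanDoctrine D c ℓ}
         (foP : IsFirstOrder C P) (foR : IsFirstOrder D R) where
  private
    module C = CartesianCategory C
    module P = Doctrine {C = C} P
    module R = Doctrine {C = D} R
    module foP = IsFirstOrder foP
    module foR = IsFirstOrder foR

  record IsFirstOrderMorphism (𝐦 : BooleanDoctrineMorphism C D P R)
    : Set (o ⊔ c ⊔ ℓ) where
    open BooleanDoctrineMorphism 𝐦
    private
      module M = Functor M
      module 𝔪 = NatTrans 𝔪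
    field
      all-homo : ∀ X Y (β : P.∣ X C.⊗ Y ∣) →
        R.At._≈_ (M.F₀ X)
          (⟦ 𝔪.η X ⟧ (foP.all X Y β))
          (foR.all (M.F₀ X) (M.F₀ Y) (⟦ 𝔪.η (X C.⊗ Y) ⟧ β R.[ θ C D preserves X Y ]))

-- The Boolean algebras live in universe o ⊔ r (o being that of the objects
-- of the base category): a subset of P X generated by quantifiers over all
-- objects Y is then again of that size.
record QFFObject (o h e r : Level) : Set (suc (o ⊔ h ⊔ e ⊔ r)) where
  field
    base         : CartesianCategory o h e
    P            : BooleanDoctrine base (o ⊔ r) (o ⊔ r)
    isFirstOrder : IsFirstOrder base P
    P₀           : Subfunctor base P (o ⊔ r)
    isQFF        : IsQuantifierFreeFragment {c = r} base P isFirstOrder P₀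

  open Subfunctor P₀ public

record QFFMorphism {o h e r : Level} (𝐏 𝐑 : QFFObject o h e r) : Set (o ⊔ h ⊔ e ⊔ r) where
  private
    module 𝐏 = QFFObject 𝐏
    module 𝐑 = QFFObject 𝐑
  field
    morphism     : BooleanDoctrineMorphism 𝐏.base 𝐑.base 𝐏.P 𝐑.P
    isFirstOrder : IsFirstOrderMorphism 𝐏.base 𝐑.base 𝐏.isFirstOrder 𝐑.isFirstOrder morphism

  open BooleanDoctrineMorphism morphism public
  open IsFirstOrderMorphism isFirstOrder public

  field
    restricts : ∀ X {α} → 𝐏.Member X α → 𝐑.Member (Functor.F₀ M X) (⟦ NatTrans.η 𝔪 X ⟧ α)

module _ {o h e r : Level} where

  _≈QFF_ : {𝐏 𝐑 : QFFObject o h e r} → Rel (QFFMorphism 𝐏 𝐑) (o ⊔ h ⊔ e ⊔ r)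
  _≈QFF_ {𝐏} {𝐑} 𝐟 𝐠 = Σ[ eq ∈ 𝐟.M ≡F 𝐠.M ]
    NatEq {C = 𝐏.base} {D = 𝐑.base} {P = 𝐏.P} {R = 𝐑.P} eq 𝐟.𝔪 𝐠.𝔪
    where
    module 𝐏 = QFFObject 𝐏
    module 𝐑 = QFFObject 𝐑
    module 𝐟 = QFFMorphism 𝐟
    module 𝐠 = QFFMorphism 𝐠

  idQFF : {𝐏 : QFFObject o h e r} → QFFMorphism 𝐏 𝐏
  idQFF {𝐏} = record
    { morphism = record
      { M         = idF _
      ; preserves = id-preserves _
      ; 𝔪         = idN {C = base} P
      }
    ; isFirstOrder = record
      { all-homo = λ X Y β → PosetHomomorphism.cong
          (IsFirstOrder.forallHom isFirstOrder X Y) (θ-id {C = base} P X Y β)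
      }
    ; restricts = λ _ m → m
    }
    where
    open QFFObject 𝐏

  _∘QFF_ : {𝐏 𝐑 𝐒 : QFFObject o h e r} → QFFMorphism 𝐑 𝐒 → QFFMorphism 𝐏 𝐑 → QFFMorphism 𝐏 𝐒
  _∘QFF_ {𝐏} {𝐑} {𝐒} 𝐠 𝐟 = record
    { morphism = record
      { M         = 𝐠.M ∘F 𝐟.M
      ; preserves = ∘-preserves 𝐠.preserves 𝐟.preserves
      ; 𝔪         = compN {C = 𝐏.base} {D = 𝐑.base} {E = 𝐒.base}
                          {P = 𝐏.P} {R = 𝐑.P} {S = 𝐒.P} {N = 𝐠.M} {M = 𝐟.M} 𝐠.𝔪 𝐟.𝔪
      }
    ; isFirstOrder = record
      { all-homo = λ X Y β →
          trans (Functor.F₀ 𝐒.P _) (BooleanHom.⟦⟧-cong (NatTrans.η 𝐠.𝔪 (𝐟.F₀ X)) (𝐟.all-homo X Y β))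
            (trans (Functor.F₀ 𝐒.P _) (𝐠.all-homo (𝐟.F₀ X) (𝐟.F₀ Y) _)
              (PosetHomomorphism.cong (IsFirstOrder.forallHom 𝐒.isFirstOrder _ _)
                (θ-comp {C = 𝐏.base} {D = 𝐑.base} {E = 𝐒.base}
                        {P = 𝐏.P} {R = 𝐑.P} {S = 𝐒.P}
                        𝐠.preserves 𝐟.preserves 𝐠.𝔪 𝐟.𝔪 X Y β)))
      }
    ; restricts = λ X m → 𝐠.restricts (𝐟.F₀ X) (𝐟.restricts X m)
    }
    where
    open BooleanAlgebra using (trans)
    module 𝐏 = QFFObject 𝐏
    module 𝐑 = QFFObject 𝐑
    module 𝐒 = QFFObject 𝐒
    module 𝐟 where
      open QFFMorphism 𝐟 public
      open Functor M public using (F₀)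
    module 𝐠 where
      open QFFMorphism 𝐠 public
      open Functor M public using (F₀)

QFF : (o h e r : Level) → Category (suc (o ⊔ h ⊔ e ⊔ r)) (o ⊔ h ⊔ e ⊔ r) (o ⊔ h ⊔ e ⊔ r)
QFF o h e r = record
  { Obj       = QFFObject o h e r
  ; _⇒_       = QFFMorphism
  ; _≈_       = _≈QFF_
  ; id        = idQFF
  ; _∘_       = _∘QFF_
  ; equiv     = λ {𝐏} {𝐑} → record
    { refl  = λ {𝐟} → ≡F-refl _ ,
        NatEq-refl {C = base 𝐏} {D = base 𝐑} {P = P 𝐏} {R = P 𝐑} {𝔪 = 𝔪 𝐟}
    ; sym   = λ {𝐟} {𝐠} (eq , q) → ≡F-sym _ eq ,
        NatEq-sym {C = base 𝐏} {D = base 𝐑} {P = P 𝐏} {R = P 𝐑} {𝔪 = 𝔪 𝐟} {𝔪′ = 𝔪 𝐠} eq q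
    ; trans = λ {𝐟} {𝐠} {𝐤} (eq , q) (eq′ , q′) → ≡F-trans _ eq eq′ ,
        NatEq-trans {C = base 𝐏} {D = base 𝐑} {P = P 𝐏} {R = P 𝐑}
          {𝔪 = 𝔪 𝐟} {𝔪′ = 𝔪 𝐠} {𝔪″ = 𝔪 𝐤} eq eq′ q q′
    }
  ; ∘-cong    = λ {𝐏} {𝐑} {𝐒} {𝐠} {𝐠′} {𝐟} {𝐟′} (eq , q) (eq′ , q′) → ≡F-∘ _ eq eq′ ,
      NatEq-∘ {C = base 𝐏} {D = base 𝐑} {E = base 𝐒} {P = P 𝐏} {R = P 𝐑} {S = P 𝐒}
        {𝔫 = 𝔪 𝐠} {𝔫′ = 𝔪 𝐠′} {𝔪 = 𝔪 𝐟} {𝔪′ = 𝔪 𝐟′} eq eq′ q q′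
  ; assoc     = λ {_} {_} {_} {𝐓} 𝐤 𝐠 𝐟 →
      record { obj≡ = λ _ → ≡.refl ; hom≈ = λ _ → id-commutes (category 𝐓) _ } ,
      λ _ _ → sym (Functor.F₀ (P 𝐓) _) (Functor.F-id (P 𝐓) _)
  ; identityˡ = λ {_} {𝐑} 𝐟 →
      record { obj≡ = λ _ → ≡.refl ; hom≈ = λ _ → id-commutes (category 𝐑) _ } ,
      λ _ _ → sym (Functor.F₀ (P 𝐑) _) (Functor.F-id (P 𝐑) _)
  ; identityʳ = λ {_} {𝐑} 𝐟 →
      record { obj≡ = λ _ → ≡.refl ; hom≈ = λ _ → id-commutes (category 𝐑) _ } ,
      λ _ _ → sym (Functor.F₀ (P 𝐑) _) (Functor.F-id (P 𝐑) _)
  }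
  where
  open QFFObject using (base; P)
  open QFFMorphism using (𝔪)
  open BooleanAlgebra using (sym)
  category : (𝐏 : QFFObject o h e r) → Category o h e
  category 𝐏 = CartesianCategory.category (base 𝐏)

module _ (C : CartesianCategory o h e) {P₀ P₁ : BooleanDoctrine C c ℓ} (i : NatTrans P₀ P₁) where
  open CartesianCategory C using (Obj; _⇒_; id; _⊗_; _⊗₁_; pr₁)
  private
    module P₀ = Doctrine {C = C} P₀
    module P₁ = Doctrine {C = C} P₁
    module i  = NatTrans i

  record IsQAOneStep : Set (o ⊔ h ⊔ c ⊔ ℓ) where
    field
      injective : ∀ X → Injective (P₀.At._≈_ X) (P₁.At._≈_ X) ⟦ i.η X ⟧

      all     : ∀ X Y → P₀.∣ X ⊗ Y ∣ → P₁.∣ X ∣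
      adjoint : ∀ X Y (β : P₀.∣ X ⊗ Y ∣) (α : P₁.∣ X ∣) →
                P₁.At._≤_ X α (all X Y β) ⇔
                P₁.At._≤_ (X ⊗ Y) (α P₁.[ pr₁ ]) (⟦ i.η (X ⊗ Y) ⟧ β)

      beckChevalley : ∀ {X X′} (f : X′ ⇒ X) Y (β : P₀.∣ X ⊗ Y ∣) →
                      P₁.At._≈_ X′ (all X Y β P₁.[ f ]) (all X′ Y (β P₀.[ f ⊗₁ id ]))

      generated : ∀ X (α : P₁.∣ X ∣) →
                  Generated (Functor.F₀ P₁ X)
                    (λ γ → ∃[ Y ] Σ[ β ∈ P₀.∣ X ⊗ Y ∣ ] P₁.At._≈_ X γ (all X Y β)) α

    all-cong : ∀ X Y {β β′} → P₀.At._≈_ (X ⊗ Y) β β′ → P₁.At._≈_ X (all X Y β) (all X Y β′)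
    all-cong X Y q = X.antisym (mono q) (mono (P₀.At.sym (X ⊗ Y) q))
      where
      module X  = Poset (poset (Functor.F₀ P₁ X))
      module XY = Poset (poset (Functor.F₀ P₁ (X ⊗ Y)))
      mono : ∀ {β β′} → P₀.At._≈_ (X ⊗ Y) β β′ → all X Y β X.≤ all X Y β′
      mono {β} {β′} q = Iff.from (adjoint X Y β′ (all X Y β))
        (XY.≤-respʳ-≈ (BooleanHom.⟦⟧-cong (i.η (X ⊗ Y)) q)
          (Iff.to (adjoint X Y β (all X Y β)) X.refl))

record QAObject (o h e r : Level) : Set (suc (o ⊔ h ⊔ e ⊔ r)) where
  field
    base : CartesianCategory o h e
    P    : ℕ → BooleanDoctrine base (o ⊔ r) (o ⊔ r)
    i    : ∀ n → NatTrans (P n) (P (sucℕ n))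
    step : ∀ n → IsQAOneStep base (i n)

  open CartesianCategory base using (_⊗_)
  module P n = Doctrine {C = base} (P n)
  module i n = NatTrans (i n)
  module step n = IsQAOneStep (step n)

  field
    compatible : ∀ n X Y (β : P.∣_∣ n (X ⊗ Y)) →
      P.At._≈_ (sucℕ (sucℕ n)) X
        (⟦ i.η (sucℕ n) X ⟧ (step.all n X Y β))
        (step.all (sucℕ n) X Y (⟦ i.η n (X ⊗ Y) ⟧ β))

record QAMorphism {o h e r : Level} (𝐏 𝐑 : QAObject o h e r) : Set (o ⊔ h ⊔ e ⊔ r) where
  private
    module 𝐏 = QAObject 𝐏
    module 𝐑 = QAObject 𝐑
    module C = CartesianCategory 𝐏.base
    module D = CartesianCategory 𝐑.base
  field
    M         : Functor C.category D.category
    preserves : PreservesFiniteProducts M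
    𝔪         : ∀ n → NatTrans (𝐏.P n) (𝐑.P n ∘F opF M)

  module M = Functor M
  module 𝔪 n = NatTrans (𝔪 n)

  field
    i-homo   : ∀ n X (α : 𝐏.P.∣_∣ n X) →
      𝐑.P.At._≈_ (sucℕ n) (M.F₀ X)
        (⟦ 𝔪.η (sucℕ n) X ⟧ (⟦ 𝐏.i.η n X ⟧ α))
        (⟦ 𝐑.i.η n (M.F₀ X) ⟧ (⟦ 𝔪.η n X ⟧ α))
    all-homo : ∀ n X Y (β : 𝐏.P.∣_∣ n (X C.⊗ Y)) →
      𝐑.P.At._≈_ (sucℕ n) (M.F₀ X)
        (⟦ 𝔪.η (sucℕ n) X ⟧ (𝐏.step.all n X Y β))
        (𝐑.step.all n (M.F₀ X) (M.F₀ Y)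
          (𝐑.P._[_] n (⟦ 𝔪.η n (X C.⊗ Y) ⟧ β) (θ 𝐏.base 𝐑.base preserves X Y)))

module _ {o h e r : Level} where

  _≈QA_ : {𝐏 𝐑 : QAObject o h e r} → Rel (QAMorphism 𝐏 𝐑) (o ⊔ h ⊔ e ⊔ r)
  _≈QA_ {𝐏} {𝐑} 𝐟 𝐠 = Σ[ eq ∈ 𝐟.M ≡F 𝐠.M ] (∀ n →
    NatEq {C = 𝐏.base} {D = 𝐑.base} {P = 𝐏.P n} {R = 𝐑.P n} eq (𝐟.𝔪 n) (𝐠.𝔪 n))
    where
    module 𝐏 = QAObject 𝐏
    module 𝐑 = QAObject 𝐑
    module 𝐟 = QAMorphism 𝐟
    module 𝐠 = QAMorphism 𝐠

  idQA : {𝐏 : QAObject o h e r} → QAMorphism 𝐏 𝐏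
  idQA {𝐏} = record
    { M         = idF _
    ; preserves = id-preserves _
    ; 𝔪         = λ n → idN {C = base} (P n)
    ; i-homo    = λ n X α → P.At.refl (sucℕ n) X
    ; all-homo  = λ n X Y β → step.all-cong n X Y (θ-id {C = base} (P n) X Y β)
    }
    where
    open QAObject 𝐏

  _∘QA_ : {𝐏 𝐑 𝐒 : QAObject o h e r} → QAMorphism 𝐑 𝐒 → QAMorphism 𝐏 𝐑 → QAMorphism 𝐏 𝐒
  _∘QA_ {𝐏} {𝐑} {𝐒} 𝐠 𝐟 = record
    { M         = 𝐠.M ∘F 𝐟.M
    ; preserves = ∘-preserves 𝐠.preserves 𝐟.preserves
    ; 𝔪         = λ n → compN {C = 𝐏.base} {D = 𝐑.base} {E = 𝐒.base}
                              {P = 𝐏.P n} {R = 𝐑.P n} {S = 𝐒.P n} {N = 𝐠.M} {M = 𝐟.M}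
                              (𝐠.𝔪 n) (𝐟.𝔪 n)
    ; i-homo    = λ n X α → 𝐒.P.At.trans (sucℕ n) _
        (BooleanHom.⟦⟧-cong (𝐠.𝔪.η (sucℕ n) (𝐟.M.F₀ X)) (𝐟.i-homo n X α))
        (𝐠.i-homo n (𝐟.M.F₀ X) _)
    ; all-homo  = λ n X Y β → 𝐒.P.At.trans (sucℕ n) _
        (BooleanHom.⟦⟧-cong (𝐠.𝔪.η (sucℕ n) (𝐟.M.F₀ X)) (𝐟.all-homo n X Y β))
        (𝐒.P.At.trans (sucℕ n) _
          (𝐠.all-homo n (𝐟.M.F₀ X) (𝐟.M.F₀ Y) _)
          (𝐒.step.all-cong n _ _
            (θ-comp {C = 𝐏.base} {D = 𝐑.base} {E = 𝐒.base}
                    {P = 𝐏.P n} {R = 𝐑.P n} {S = 𝐒.P n}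
                    𝐠.preserves 𝐟.preserves (𝐠.𝔪 n) (𝐟.𝔪 n) X Y β)))
    }
    where
    module 𝐏 = QAObject 𝐏
    module 𝐑 = QAObject 𝐑
    module 𝐒 = QAObject 𝐒
    module 𝐟 = QAMorphism 𝐟
    module 𝐠 = QAMorphism 𝐠

QA : (o h e r : Level) → Category (suc (o ⊔ h ⊔ e ⊔ r)) (o ⊔ h ⊔ e ⊔ r) (o ⊔ h ⊔ e ⊔ r)
QA o h e r = record
  { Obj       = QAObject o h e r
  ; _⇒_       = QAMorphism
  ; _≈_       = _≈QA_
  ; id        = idQA
  ; _∘_       = _∘QA_
  ; equiv     = λ {𝐏} {𝐑} → record
    { refl  = λ {𝐟} → ≡F-refl _ , λ n →
        NatEq-refl {C = base 𝐏} {D = base 𝐑} {P = P 𝐏 n} {R = P 𝐑 n} {𝔪 = 𝔪 𝐟 n}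
    ; sym   = λ {𝐟} {𝐠} (eq , q) → ≡F-sym _ eq , λ n →
        NatEq-sym {C = base 𝐏} {D = base 𝐑} {P = P 𝐏 n} {R = P 𝐑 n}
          {𝔪 = 𝔪 𝐟 n} {𝔪′ = 𝔪 𝐠 n} eq (q n)
    ; trans = λ {𝐟} {𝐠} {𝐤} (eq , q) (eq′ , q′) → ≡F-trans _ eq eq′ , λ n →
        NatEq-trans {C = base 𝐏} {D = base 𝐑} {P = P 𝐏 n} {R = P 𝐑 n}
          {𝔪 = 𝔪 𝐟 n} {𝔪′ = 𝔪 𝐠 n} {𝔪″ = 𝔪 𝐤 n} eq eq′ (q n) (q′ n)
    }
  ; ∘-cong    = λ {𝐏} {𝐑} {𝐒} {𝐠} {𝐠′} {𝐟} {𝐟′} (eq , q) (eq′ , q′) → ≡F-∘ _ eq eq′ , λ n →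
      NatEq-∘ {C = base 𝐏} {D = base 𝐑} {E = base 𝐒} {P = P 𝐏 n} {R = P 𝐑 n} {S = P 𝐒 n}
        {𝔫 = 𝔪 𝐠 n} {𝔫′ = 𝔪 𝐠′ n} {𝔪 = 𝔪 𝐟 n} {𝔪′ = 𝔪 𝐟′ n} eq eq′ (q n) (q′ n)
  ; assoc     = λ {_} {_} {_} {𝐓} 𝐤 𝐠 𝐟 →
      record { obj≡ = λ _ → ≡.refl ; hom≈ = λ _ → id-commutes (category 𝐓) _ } ,
      λ n _ _ → sym (Functor.F₀ (P 𝐓 n) _) (Functor.F-id (P 𝐓 n) _)
  ; identityˡ = λ {_} {𝐑} 𝐟 →
      record { obj≡ = λ _ → ≡.refl ; hom≈ = λ _ → id-commutes (category 𝐑) _ } ,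
      λ n _ _ → sym (Functor.F₀ (P 𝐑 n) _) (Functor.F-id (P 𝐑 n) _)
  ; identityʳ = λ {_} {𝐑} 𝐟 →
      record { obj≡ = λ _ → ≡.refl ; hom≈ = λ _ → id-commutes (category 𝐑) _ } ,
      λ n _ _ → sym (Functor.F₀ (P 𝐑 n) _) (Functor.F-id (P 𝐑 n) _)
  }
  where
  open QAObject using (base; P)
  open QAMorphism using (𝔪)
  open BooleanAlgebra using (sym)
  category : (𝐏 : QAObject o h e r) → Category o h e
  category 𝐏 = CartesianCategory.category (base 𝐏)

{-# OPTIONS --safe #-}

-- A quantifier-free fragment P₀ of P is sent to the sequence of its layers Pₙ, which are
-- increasing because α = (∀X)(P(pr₁) α).  A stratified doctrine is sent to the colimit of
-- its algebras with (∀Y)[β] = [(∀Y)β] one stage up; since the transition maps are injective,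
-- an inequality in the colimit holds at every stage where both sides live, so the one-step
-- adjunctions give the adjunction, and each Pₙ is the n-th layer over P₀ because Pₙ₊₁ is
-- generated by the quantifiers.  The comparison maps colim Pₙ → P (bijective by exhaustion)
-- and Pₙ → n-th layer of colim Pₙ are then isomorphisms lying over the identity functor.

module Submission where

open import Level using (Level; _⊔_)
open import Defs

open import Algebra.Lattice.Bundles using (BooleanAlgebra)
open import Algebra.Lattice.Structures using (IsBooleanAlgebra)
open import Algebra.Lattice.Structures.Biased
  using (isDistributiveLatticeʳʲᵐ; isBooleanAlgebraʳ)
open import Data.Empty using (⊥-elim)
open import Data.Nat.Base using (ℕ; zero; suc; _≤_; z≤n; _≤′_; ≤′-reflexive; ≤′-refl; ≤′-step)
  renaming (_⊔_ to _⊔ℕ_)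
open import Data.Nat.Properties
  using ( ≤-refl; ≤-trans; 1+n≰n; ≡-irrelevant; ≤⇒≤′; ≤′⇒≤; n≤1+n
        ; m≤m⊔n; m≤n⊔m; ⊔-lub)
open import Data.Product.Base using (Σ; Σ-syntax; ∃; ∃-syntax; _×_; _,_; proj₁; proj₂)
open import Function.Bundles using (mk⇔) renaming (module Equivalence to Iff)
open import Function.Definitions using (Injective)
open import Relation.Binary.Bundles using (Poset; Setoid)
open import Relation.Binary.Definitions using (Adjoint)
open import Relation.Binary.Morphism.Bundles using (PosetHomomorphism)
open import Relation.Binary.PropositionalEquality.Core as ≡ using (_≡_)
open import Relation.Unary using (Pred)

open BooleanHom using (⟦_⟧)

private
  variable
    o h e r c ℓ ℓ′ ℓ″ : Level

-- Boolean homomorphisms and subalgebras.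

module _ {A B : BooleanAlgebra c ℓ} (f : BooleanHom A B) where
  private
    module A = BooleanAlgebra A
    module B = BooleanAlgebra B
    module f = BooleanHom f
    open Poset (poset A) using () renaming (_≤_ to _≤ᴬ_)
    open Poset (poset B) using () renaming (_≤_ to _≤ᴮ_)

  hom-mono : ∀ {x y} → x ≤ᴬ y → ⟦ f ⟧ x ≤ᴮ ⟦ f ⟧ y
  hom-mono x≤y = B.trans (f.⟦⟧-cong x≤y) (f.∧-homo _ _)

  module _ (injective : Injective A._≈_ B._≈_ ⟦ f ⟧) where

    -- The order is the equation `x ≈ x ∧ y`, which an injective homomorphism reflects.
    hom-cancel-≤ : ∀ {x y} → ⟦ f ⟧ x ≤ᴮ ⟦ f ⟧ y → x ≤ᴬ y
    hom-cancel-≤ fx≤fy = injective (B.trans fx≤fy (B.sym (f.∧-homo _ _)))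

    -- Every law for `g`, congruence included, becomes a law of `f` after applying `f`, and
    -- injectivity reflects it. Hence `g` may be an arbitrary choice of preimages.
    inverseHom : (g : B.Carrier → A.Carrier) → (∀ y → ⟦ f ⟧ (g y) B.≈ y) → BooleanHom B A
    inverseHom g f∘g = record
      { ⟦_⟧ = g
      ; isLatticeHomomorphism = record
        { isRelHomomorphism = record
          { cong = λ {x} {y} x≈y → injective (B.trans (f∘g x) (B.trans x≈y (B.sym (f∘g y)))) }
        ; ∧-homo = λ x y → injective (B.trans (f∘g _)
            (B.sym (B.trans (f.∧-homo _ _) (B.∧-cong (f∘g x) (f∘g y)))))
        ; ∨-homo = λ x y → injective (B.trans (f∘g _)
            (B.sym (B.trans (f.∨-homo _ _) (B.∨-cong (f∘g x) (f∘g y)))))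
        }
      ; ¬-homo = λ x → injective (B.trans (f∘g _)
          (B.sym (B.trans (f.¬-homo _) (B.¬-cong (f∘g x)))))
      ; ⊤-homo = injective (B.trans (f∘g _) (B.sym f.⊤-homo))
      ; ⊥-homo = injective (B.trans (f∘g _) (B.sym f.⊥-homo))
      }

module _ (B : BooleanAlgebra c ℓ) where
  private
    module B = BooleanAlgebra B

  Generated-isSubalgebra : (S : Pred B.Carrier ℓ′) → IsSubalgebra B (Generated B S)
  Generated-isSubalgebra S = record
    { resp     = resp
    ; ∨-closed = _∨ᵍ_
    ; ∧-closed = _∧ᵍ_
    ; ¬-closed = ¬ᵍ_
    ; ⊤-closed = ⊤ᵍ
    ; ⊥-closed = ⊥ᵍ
    }

  Generated-least : {S : Pred B.Carrier ℓ′} {T : Pred B.Carrier ℓ″} →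
                    IsSubalgebra B T → (∀ {x} → S x → T x) → ∀ {x} → Generated B S x → T x
  Generated-least {S = S} {T = T} sub S⊆T = go
    where
    open IsSubalgebra sub renaming (resp to T-resp)
    go : ∀ {x} → Generated B S x → T x
    go (incl s)     = S⊆T s
    go (resp x≈y d) = T-resp x≈y (go d)
    go (d ∨ᵍ d′)    = ∨-closed (go d) (go d′)
    go (d ∧ᵍ d′)    = ∧-closed (go d) (go d′)
    go (¬ᵍ d)       = ¬-closed (go d)
    go ⊤ᵍ           = ⊤-closed
    go ⊥ᵍ           = ⊥-closed

  module _ {S : Pred B.Carrier ℓ′} (sub : IsSubalgebra B S) where
    open IsSubalgebra sub

    -- Equality compares elements and ignores membership proofs, so every axiom is inherited and
    -- inclusions of subalgebras are injective by definition.
    subalgebra : BooleanAlgebra (c ⊔ ℓ′) ℓ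
    subalgebra = record
      { Carrier = Σ B.Carrier S
      ; _≈_     = λ x y → proj₁ x B.≈ proj₁ y
      ; _∨_     = λ (x , s) (y , t) → x B.∨ y , ∨-closed s t
      ; _∧_     = λ (x , s) (y , t) → x B.∧ y , ∧-closed s t
      ; ¬_      = λ (x , s) → B.¬ x , ¬-closed s
      ; ⊤       = B.⊤ , ⊤-closed
      ; ⊥       = B.⊥ , ⊥-closed
      ; isBooleanAlgebra = record
        { isDistributiveLattice = record
          { isLattice = record
            { isEquivalence = record { refl = B.refl ; sym = B.sym ; trans = B.trans }
            ; ∨-comm        = λ _ _ → B.∨-comm _ _
            ; ∨-assoc       = λ _ _ _ → B.∨-assoc _ _ _
            ; ∨-cong        = B.∨-cong
            ; ∧-comm        = λ _ _ → B.∧-comm _ _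
            ; ∧-assoc       = λ _ _ _ → B.∧-assoc _ _ _
            ; ∧-cong        = B.∧-cong
            ; absorptive    = (λ _ _ → B.∨-absorbs-∧ _ _) , (λ _ _ → B.∧-absorbs-∨ _ _)
            }
          ; ∨-distrib-∧ = (λ _ _ _ → B.∨-distribˡ-∧ _ _ _) , (λ _ _ _ → B.∨-distribʳ-∧ _ _ _)
          ; ∧-distrib-∨ = (λ _ _ _ → B.∧-distribˡ-∨ _ _ _) , (λ _ _ _ → B.∧-distribʳ-∨ _ _ _)
          }
        ; ∨-complement = (λ _ → B.∨-complementˡ _) , (λ _ → B.∨-complementʳ _)
        ; ∧-complement = (λ _ → B.∧-complementˡ _) , (λ _ → B.∧-complementʳ _)
        ; ¬-cong       = B.¬-cong
        }
      }

module _ {B : BooleanAlgebra c c} {T : Pred (BooleanAlgebra.Carrier B) c}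
         (sub : IsSubalgebra B T) where
  private
    module B = BooleanAlgebra B

  inclusionHom : BooleanHom (subalgebra B sub) B
  inclusionHom = record
    { ⟦_⟧ = proj₁
    ; isLatticeHomomorphism = record
      { isRelHomomorphism = record { cong = λ x≈y → x≈y }
      ; ∧-homo = λ _ _ → B.refl
      ; ∨-homo = λ _ _ → B.refl
      }
    ; ¬-homo = λ _ → B.refl
    ; ⊤-homo = B.refl
    ; ⊥-homo = B.refl
    }

  corestrictHom : {A : BooleanAlgebra c c} (f : BooleanHom A B) →
                  (∀ x → T (⟦ f ⟧ x)) → BooleanHom A (subalgebra B sub)
  corestrictHom f f∈T = record
    { ⟦_⟧ = λ x → ⟦ f ⟧ x , f∈T x
    ; isLatticeHomomorphism = record
      { isRelHomomorphism = record { cong = f.⟦⟧-cong }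
      ; ∧-homo = f.∧-homo
      ; ∨-homo = f.∨-homo
      }
    ; ¬-homo = f.¬-homo
    ; ⊤-homo = f.⊤-homo
    ; ⊥-homo = f.⊥-homo
    }
    where
    module f = BooleanHom f

module _ {A B : BooleanAlgebra c c} {S : Pred (BooleanAlgebra.Carrier A) c}
         {T : Pred (BooleanAlgebra.Carrier B) c}
         (subA : IsSubalgebra A S) (subB : IsSubalgebra B T) where

  restrictHom : (f : BooleanHom A B) → (∀ {x} → S x → T (⟦ f ⟧ x)) →
                BooleanHom (subalgebra A subA) (subalgebra B subB)
  restrictHom f S⊆T = corestrictHom subB (Category._∘_ (BA _ _) f (inclusionHom subA))
    λ (_ , s) → S⊆T s

module _ {A B : BooleanAlgebra c ℓ} (f : BooleanHom A B) where
  private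
    module A = BooleanAlgebra A
    module B = BooleanAlgebra B
    module f = BooleanHom f

  preimage-isSubalgebra : {T : Pred B.Carrier ℓ′} → IsSubalgebra B T →
                          IsSubalgebra A (λ x → T (⟦ f ⟧ x))
  preimage-isSubalgebra sub = record
    { resp     = λ x≈y → T.resp (f.⟦⟧-cong x≈y)
    ; ∨-closed = λ s t → T.resp (B.sym (f.∨-homo _ _)) (T.∨-closed s t)
    ; ∧-closed = λ s t → T.resp (B.sym (f.∧-homo _ _)) (T.∧-closed s t)
    ; ¬-closed = λ s → T.resp (B.sym (f.¬-homo _)) (T.¬-closed s)
    ; ⊤-closed = T.resp (B.sym f.⊤-homo) T.⊤-closed
    ; ⊥-closed = T.resp (B.sym f.⊥-homo) T.⊥-closed
    }
    where
    module T = IsSubalgebra sub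

  image-isSubalgebra : IsSubalgebra B (λ y → ∃[ x ] y B.≈ ⟦ f ⟧ x)
  image-isSubalgebra = record
    { resp     = λ y≈z (x , y≈fx) → x , B.trans (B.sym y≈z) y≈fx
    ; ∨-closed = λ (_ , p) (_ , q) → _ , B.trans (B.∨-cong p q) (B.sym (f.∨-homo _ _))
    ; ∧-closed = λ (_ , p) (_ , q) → _ , B.trans (B.∧-cong p q) (B.sym (f.∧-homo _ _))
    ; ¬-closed = λ (_ , p) → _ , B.trans (B.¬-cong p) (B.sym (f.¬-homo _))
    ; ⊤-closed = _ , B.sym f.⊤-homo
    ; ⊥-closed = _ , B.sym f.⊥-homo
    }

-- Colimits of chains of Boolean algebras with injective transition maps.

≤′-irrelevant : ∀ {m n} (p q : m ≤′ n) → p ≡ q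
≤′-irrelevant (≤′-reflexive p) (≤′-reflexive q) = ≡.cong ≤′-reflexive (≡-irrelevant p q)
≤′-irrelevant (≤′-step p) (≤′-step q) = ≡.cong ≤′-step (≤′-irrelevant p q)
-- In the mixed cases the two ends coincide, so the proof under `≤′-step` would bound a successor by
-- its predecessor.
≤′-irrelevant ≤′-refl (≤′-step q) = ⊥-elim (1+n≰n (≤′⇒≤ q))
≤′-irrelevant (≤′-step p) ≤′-refl = ⊥-elim (1+n≰n (≤′⇒≤ p))

module Colimit
  (A : ℕ → BooleanAlgebra c ℓ)
  (i : ∀ n → BooleanHom (A n) (A (suc n)))
  (i-injective : ∀ n → Injective (BooleanAlgebra._≈_ (A n)) (BooleanAlgebra._≈_ (A (suc n)))
                                 ⟦ i n ⟧)
  where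
  private
    module A n = BooleanAlgebra (A n)
    module i n = BooleanHom (i n)
    open module A′ {n} = BooleanAlgebra (A n) using (_≈_; _∧_; _∨_; ¬_; ⊤; ⊥; refl; sym; trans)

  lift′ : ∀ {m n} → m ≤′ n → BooleanHom (A m) (A n)
  lift′ ≤′-refl     = Category.id (BA c ℓ)
  lift′ (≤′-step p) = Category._∘_ (BA c ℓ) (i _) (lift′ p)

  lift : ∀ {m n} → m ≤ n → BooleanHom (A m) (A n)
  lift p = lift′ (≤⇒≤′ p)

  module lift {m n} (p : m ≤ n) = BooleanHom (lift p)

  -- Transition maps recurse on a proof of the inequality. Such proofs are unique, so the map
  -- depends on its two stages alone.
  lift≈lift′ : ∀ {m n} (p : m ≤ n) (q : m ≤′ n) a → ⟦ lift p ⟧ a ≈ ⟦ lift′ q ⟧ a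
  lift≈lift′ p q a = A′.reflexive (≡.cong (λ q → ⟦ lift′ q ⟧ a) (≤′-irrelevant (≤⇒≤′ p) q))

  lift-refl : ∀ {n} (p : n ≤ n) a → ⟦ lift p ⟧ a ≈ a
  lift-refl p = lift≈lift′ p ≤′-refl

  lift-suc : ∀ {m n} (p : m ≤ n) (q : m ≤ suc n) a → ⟦ lift q ⟧ a ≈ ⟦ i n ⟧ (⟦ lift p ⟧ a)
  lift-suc p q = lift≈lift′ q (≤′-step (≤⇒≤′ p))

  lift-trans : ∀ {l m n} (p : l ≤ m) (q : m ≤ n) (r : l ≤ n) a →
               ⟦ lift r ⟧ a ≈ ⟦ lift q ⟧ (⟦ lift p ⟧ a)
  lift-trans p q r a = go (≤⇒≤′ q) r
    where
    go : ∀ {n} (q : _ ≤′ n) (r : _ ≤ n) → ⟦ lift r ⟧ a ≈ ⟦ lift′ q ⟧ (⟦ lift p ⟧ a)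
    go ≤′-refl     r = lift≈lift′ r (≤⇒≤′ p) a
    go (≤′-step q) r =
      trans (lift-suc r′ r a) (i.⟦⟧-cong _ (go q r′))
      where
      r′ = ≤-trans p (≤′⇒≤ q)

  lift-injective : ∀ {m n} (p : m ≤ n) {a b} → ⟦ lift p ⟧ a ≈ ⟦ lift p ⟧ b → a ≈ b
  lift-injective p = go (≤⇒≤′ p)
    where
    go : ∀ {n} (p : _ ≤′ n) {a b} → ⟦ lift′ p ⟧ a ≈ ⟦ lift′ p ⟧ b → a ≈ b
    go ≤′-refl     q = q
    go (≤′-step p) q = go p (i-injective _ q)

  infix 4 _↓_ _∼_

  Carrier : Set c
  Carrier = Σ ℕ A.Carrier

  -- x ↓ a : the element x of the colimit is represented by a at stage k.
  record _↓_ (x : Carrier) {k} (a : A.Carrier k) : Set ℓ where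
    constructor _,_
    field
      bound : proj₁ x ≤ k
      value : ⟦ lift bound ⟧ (proj₂ x) ≈ a

  -- Agreement is required at all common stages rather than at some. The two are equivalent because
  -- the transition maps are injective, and this form can be used at whichever stage is at hand.
  record _∼_ (x y : Carrier) : Set ℓ where
    constructor agree
    field
      agreement : ∀ {k} (p : proj₁ x ≤ k) (q : proj₁ y ≤ k) →
                  ⟦ lift p ⟧ (proj₂ x) ≈ ⟦ lift q ⟧ (proj₂ y)

  ↓-refl : ∀ {n} a → (n , a) ↓ a
  ↓-refl a = ≤-refl , lift-refl ≤-refl a

  ↓-lift : ∀ {x k} → proj₁ x ≤ k → ∃ λ (a : A.Carrier k) → x ↓ a
  ↓-lift p = _ , (p , refl)

  ↓-mono : ∀ {x k l} {a : A.Carrier k} (q : k ≤ l) → x ↓ a → x ↓ ⟦ lift q ⟧ a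
  ↓-mono q (p , v) = ≤-trans p q , trans (lift-trans p q (≤-trans p q) _) (lift.⟦⟧-cong q v)

  ↓-step : ∀ {n} a → (n , a) ↓ ⟦ i n ⟧ a
  ↓-step {n} a = n≤1+n n , trans (lift-suc ≤-refl (n≤1+n n) a) (i.⟦⟧-cong n (lift-refl ≤-refl a))

  ∼-elim : ∀ {x y k} {a b : A.Carrier k} → x ∼ y → x ↓ a → y ↓ b → a ≈ b
  ∼-elim (agree eq) (p , v) (q , w) = trans (sym v) (trans (eq p q) w)

  ∼-refl : ∀ {x} → x ∼ x
  ∼-refl = agree λ p q → lift≈lift′ p (≤⇒≤′ q) _

  -- Agreement at one stage `k` spreads to any other stage `l`: transport it up to the maximum of
  -- `k` and `l`, then come back down to `l` by injectivity.
  ∼-intro : ∀ {x y k} {a b : A.Carrier k} → x ↓ a → y ↓ b → a ≈ b → x ∼ y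
  ∼-intro {k = k} x↓a y↓b a≈b = agree λ {l} p q →
    lift-injective (m≤n⊔m k l)
      (trans (∼-elim ∼-refl (↓-mono (m≤n⊔m k l) (p , refl)) (↓-mono (m≤m⊔n k l) x↓a))
        (trans (lift.⟦⟧-cong (m≤m⊔n k l) a≈b)
          (∼-elim ∼-refl (↓-mono (m≤m⊔n k l) y↓b) (↓-mono (m≤n⊔m k l) (q , refl)))))

  ↓⇒∼ : ∀ {x k} {a : A.Carrier k} → x ↓ a → x ∼ (k , a)
  ↓⇒∼ x↓a = ∼-intro x↓a (↓-refl _) refl

  ∼-lift : ∀ {x k} (p : proj₁ x ≤ k) → x ∼ (k , ⟦ lift p ⟧ (proj₂ x))
  ∼-lift p = ↓⇒∼ (p , refl)

  common : ∀ w x y z → ∃[ k ] ∃ (λ (a : A.Carrier k) → w ↓ a) ×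
                              ∃ (λ (a : A.Carrier k) → x ↓ a) ×
                              ∃ (λ (a : A.Carrier k) → y ↓ a) ×
                              ∃ (λ (a : A.Carrier k) → z ↓ a)
  common (l , _) (m , _) (n , _) (o , _) = (l ⊔ℕ m) ⊔ℕ (n ⊔ℕ o) ,
    ↓-lift (≤-trans (m≤m⊔n l m) (m≤m⊔n (l ⊔ℕ m) (n ⊔ℕ o))) ,
    ↓-lift (≤-trans (m≤n⊔m l m) (m≤m⊔n (l ⊔ℕ m) (n ⊔ℕ o))) ,
    ↓-lift (≤-trans (m≤m⊔n n o) (m≤n⊔m (l ⊔ℕ m) (n ⊔ℕ o))) ,
    ↓-lift (≤-trans (m≤n⊔m n o) (m≤n⊔m (l ⊔ℕ m) (n ⊔ℕ o)))

  ∼-sym : ∀ {x y} → x ∼ y → y ∼ x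
  ∼-sym (agree eq) = agree λ p q → sym (eq q p)

  ∼-trans : ∀ {x y z} → x ∼ y → y ∼ z → x ∼ z
  ∼-trans {x} {y} {z} x∼y y∼z with common x y z z
  ... | _ , (_ , x↓) , (_ , y↓) , (_ , z↓) , _ =
    ∼-intro x↓ z↓ (trans (∼-elim x∼y x↓ y↓) (∼-elim y∼z y↓ z↓))

  infixr 7 _⋏_
  infixr 6 _⋎_
  infix  8 ~_

  _⋏_ _⋎_ : Carrier → Carrier → Carrier
  (m , a) ⋏ (n , b) = m ⊔ℕ n , ⟦ lift (m≤m⊔n m n) ⟧ a ∧ ⟦ lift (m≤n⊔m m n) ⟧ b
  (m , a) ⋎ (n , b) = m ⊔ℕ n , ⟦ lift (m≤m⊔n m n) ⟧ a ∨ ⟦ lift (m≤n⊔m m n) ⟧ b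

  ~_ : Carrier → Carrier
  ~ (n , a) = n , ¬ a

  module _ {x y k} {a b : A.Carrier k} (x↓a : x ↓ a) (y↓b : y ↓ b) where
    private
      m = proj₁ x
      n = proj₁ y
      m⊔n≤k : m ⊔ℕ n ≤ k
      m⊔n≤k = ⊔-lub (_↓_.bound x↓a) (_↓_.bound y↓b)
      left : ⟦ lift m⊔n≤k ⟧ (⟦ lift (m≤m⊔n m n) ⟧ (proj₂ x)) ≈ a
      left = ∼-elim ∼-refl (↓-mono m⊔n≤k (m≤m⊔n m n , refl)) x↓a
      right : ⟦ lift m⊔n≤k ⟧ (⟦ lift (m≤n⊔m m n) ⟧ (proj₂ y)) ≈ b
      right = ∼-elim ∼-refl (↓-mono m⊔n≤k (m≤n⊔m m n , refl)) y↓b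

    -- The meet is formed at stage `m ⊔ n`, but the transition map from there to `k` is a
    -- homomorphism, so it may be computed at any stage representing both arguments.
    ↓-∧ : x ⋏ y ↓ a ∧ b
    ↓-∧ = m⊔n≤k , trans (lift.∧-homo m⊔n≤k _ _) (A.∧-cong k left right)

    ↓-∨ : x ⋎ y ↓ a ∨ b
    ↓-∨ = m⊔n≤k , trans (lift.∨-homo m⊔n≤k _ _) (A.∨-cong k left right)

  ↓-¬ : ∀ {x k} {a : A.Carrier k} → x ↓ a → ~ x ↓ ¬ a
  ↓-¬ {k = k} (p , v) = p , trans (lift.¬-homo p _) (A.¬-cong k v)

  ↓-⊤ : ∀ {n k} → n ≤ k → (n , ⊤) ↓ ⊤ {k}
  ↓-⊤ p = p , lift.⊤-homo p

  ↓-⊥ : ∀ {n k} → n ≤ k → (n , ⊥) ↓ ⊥ {k}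
  ↓-⊥ p = p , lift.⊥-homo p

  ⋏-cong : ∀ {x y u v} → x ∼ y → u ∼ v → x ⋏ u ∼ y ⋏ v
  ⋏-cong {x} {y} {u} {v} x∼y u∼v with common x y u v
  ... | k , (_ , x↓) , (_ , y↓) , (_ , u↓) , (_ , v↓) =
    ∼-intro (↓-∧ x↓ u↓) (↓-∧ y↓ v↓) (A.∧-cong k (∼-elim x∼y x↓ y↓) (∼-elim u∼v u↓ v↓))

  ⋎-cong : ∀ {x y u v} → x ∼ y → u ∼ v → x ⋎ u ∼ y ⋎ v
  ⋎-cong {x} {y} {u} {v} x∼y u∼v with common x y u v
  ... | k , (_ , x↓) , (_ , y↓) , (_ , u↓) , (_ , v↓) =
    ∼-intro (↓-∨ x↓ u↓) (↓-∨ y↓ v↓) (A.∨-cong k (∼-elim x∼y x↓ y↓) (∼-elim u∼v u↓ v↓))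

  ~-cong : ∀ {x y} → x ∼ y → ~ x ∼ ~ y
  ~-cong {x} {y} x∼y with common x y y y
  ... | k , (_ , x↓) , (_ , y↓) , _ =
    ∼-intro (↓-¬ x↓) (↓-¬ y↓) (A.¬-cong k (∼-elim x∼y x↓ y↓))

  ⋏-comm : ∀ x y → x ⋏ y ∼ y ⋏ x
  ⋏-comm x y with common x y y y
  ... | k , (_ , x↓) , (_ , y↓) , _ = ∼-intro (↓-∧ x↓ y↓) (↓-∧ y↓ x↓) (A.∧-comm k _ _)

  ⋎-comm : ∀ x y → x ⋎ y ∼ y ⋎ x
  ⋎-comm x y with common x y y y
  ... | k , (_ , x↓) , (_ , y↓) , _ = ∼-intro (↓-∨ x↓ y↓) (↓-∨ y↓ x↓) (A.∨-comm k _ _)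

  ⋏-assoc : ∀ x y z → (x ⋏ y) ⋏ z ∼ x ⋏ (y ⋏ z)
  ⋏-assoc x y z with common x y z z
  ... | k , (_ , x↓) , (_ , y↓) , (_ , z↓) , _ =
    ∼-intro (↓-∧ (↓-∧ x↓ y↓) z↓) (↓-∧ x↓ (↓-∧ y↓ z↓)) (A.∧-assoc k _ _ _)

  ⋎-assoc : ∀ x y z → (x ⋎ y) ⋎ z ∼ x ⋎ (y ⋎ z)
  ⋎-assoc x y z with common x y z z
  ... | k , (_ , x↓) , (_ , y↓) , (_ , z↓) , _ =
    ∼-intro (↓-∨ (↓-∨ x↓ y↓) z↓) (↓-∨ x↓ (↓-∨ y↓ z↓)) (A.∨-assoc k _ _ _)

  ⋎-absorbs-⋏ : ∀ x y → x ⋎ (x ⋏ y) ∼ x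
  ⋎-absorbs-⋏ x y with common x y y y
  ... | k , (_ , x↓) , (_ , y↓) , _ =
    ∼-intro (↓-∨ x↓ (↓-∧ x↓ y↓)) x↓ (A.∨-absorbs-∧ k _ _)

  ⋏-absorbs-⋎ : ∀ x y → x ⋏ (x ⋎ y) ∼ x
  ⋏-absorbs-⋎ x y with common x y y y
  ... | k , (_ , x↓) , (_ , y↓) , _ =
    ∼-intro (↓-∧ x↓ (↓-∨ x↓ y↓)) x↓ (A.∧-absorbs-∨ k _ _)

  ⋎-distribʳ-⋏ : ∀ x y z → (y ⋏ z) ⋎ x ∼ (y ⋎ x) ⋏ (z ⋎ x)
  ⋎-distribʳ-⋏ x y z with common x y z z
  ... | k , (_ , x↓) , (_ , y↓) , (_ , z↓) , _ =
    ∼-intro (↓-∨ (↓-∧ y↓ z↓) x↓) (↓-∧ (↓-∨ y↓ x↓) (↓-∨ z↓ x↓)) (A.∨-distribʳ-∧ k _ _ _)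

  ⋎-complementʳ : ∀ x → x ⋎ ~ x ∼ (zero , ⊤)
  ⋎-complementʳ x with common x (zero , ⊤) x x
  ... | k , (_ , x↓) , (_ , ⊤↓) , _ =
    ∼-intro (↓-∨ x↓ (↓-¬ x↓)) (↓-⊤ (_↓_.bound ⊤↓)) (A.∨-complementʳ k _)

  ⋏-complementʳ : ∀ x → x ⋏ ~ x ∼ (zero , ⊥)
  ⋏-complementʳ x with common x (zero , ⊥) x x
  ... | k , (_ , x↓) , (_ , ⊥↓) , _ =
    ∼-intro (↓-∧ x↓ (↓-¬ x↓)) (↓-⊥ (_↓_.bound ⊥↓)) (A.∧-complementʳ k _)

  -- Abstract, so that comparing two colimits does not unfold the proofs of the axioms.
  abstract
    isBooleanAlgebra : IsBooleanAlgebra _∼_ _⋎_ _⋏_ ~_ (zero , ⊤) (zero , ⊥)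
    isBooleanAlgebra = isBooleanAlgebraʳ record
      { isDistributiveLattice = isDistributiveLatticeʳʲᵐ record
        { isLattice = record
          { isEquivalence = record { refl = ∼-refl ; sym = ∼-sym ; trans = ∼-trans }
          ; ∨-comm        = ⋎-comm
          ; ∨-assoc       = ⋎-assoc
          ; ∨-cong        = ⋎-cong
          ; ∧-comm        = ⋏-comm
          ; ∧-assoc       = ⋏-assoc
          ; ∧-cong        = ⋏-cong
          ; absorptive    = ⋎-absorbs-⋏ , ⋏-absorbs-⋎
          }
        ; ∨-distribʳ-∧ = ⋎-distribʳ-⋏
        }
      ; ∨-complementʳ = ⋎-complementʳ
      ; ∧-complementʳ = ⋏-complementʳ
      ; ¬-cong        = ~-cong
      }

  colimit : BooleanAlgebra c ℓ
  colimit = record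
    { Carrier          = Carrier
    ; _≈_              = _∼_
    ; _∨_              = _⋎_
    ; _∧_              = _⋏_
    ; ¬_               = ~_
    ; ⊤                = zero , ⊤
    ; ⊥                = zero , ⊥
    ; isBooleanAlgebra = isBooleanAlgebra
    }

  ins-injective : ∀ {n} {a b : A.Carrier n} → (n , a) ∼ (n , b) → a ≈ b
  ins-injective {a = a} {b} eq = ∼-elim eq (↓-refl a) (↓-refl b)

  ins-cong : ∀ {n} {a b : A.Carrier n} → a ≈ b → (n , a) ∼ (n , b)
  ins-cong {a = a} {b} = ∼-intro (↓-refl a) (↓-refl b)

  ins-suc : ∀ {n} (a : A.Carrier n) → (n , a) ∼ (suc n , ⟦ i n ⟧ a)
  ins-suc a = ↓⇒∼ (↓-step a)

  ins : ∀ n → BooleanHom (A n) colimit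
  ins n = record
    { ⟦_⟧ = n ,_
    ; isLatticeHomomorphism = record
      { isRelHomomorphism = record { cong = ins-cong }
      ; ∧-homo = λ a b → ∼-sym (↓⇒∼ (↓-∧ (↓-refl a) (↓-refl b)))
      ; ∨-homo = λ a b → ∼-sym (↓⇒∼ (↓-∨ (↓-refl a) (↓-refl b)))
      }
    ; ¬-homo = λ a → ∼-refl
    ; ⊤-homo = ∼-sym (↓⇒∼ (↓-⊤ z≤n))
    ; ⊥-homo = ∼-sym (↓⇒∼ (↓-⊥ z≤n))
    }

  module _ (S : Setoid ℓ′ ℓ″) (g : Carrier → Setoid.Carrier S)
    (g-cong : ∀ {n} {a b : A.Carrier n} → a ≈ b → Setoid._≈_ S (g (n , a)) (g (n , b)))
    (g-suc : ∀ n a → Setoid._≈_ S (g (n , a)) (g (suc n , ⟦ i n ⟧ a)))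
    where
    private
      module S = Setoid S

    glue-lift : ∀ {m n} (p : m ≤ n) a → g (m , a) S.≈ g (n , ⟦ lift p ⟧ a)
    glue-lift p a = go (≤⇒≤′ p)
      where
      go : ∀ {n} (p : _ ≤′ n) → g (_ , a) S.≈ g (n , ⟦ lift′ p ⟧ a)
      go ≤′-refl     = S.refl
      go (≤′-step p) = S.trans (go p) (g-suc _ _)

    -- Both arguments move to the maximum of their stages, where they agree. The target is a mere
    -- setoid so that this also covers quantifiers, which are not homomorphisms.
    glue-cong : ∀ {x y} → x ∼ y → g x S.≈ g y
    glue-cong {m , a} {n , b} (agree eq) =
      S.trans (glue-lift p a) (S.trans (g-cong (eq p q)) (S.sym (glue-lift q b)))
      where
      p = m≤m⊔n m n
      q = m≤n⊔m m n

  module _ {B : BooleanAlgebra c ℓ} (g : ∀ n → BooleanHom (A n) B)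
    (g-suc : ∀ n a → BooleanAlgebra._≈_ B (⟦ g n ⟧ a) (⟦ g (suc n) ⟧ (⟦ i n ⟧ a)))
    where
    private
      module B   = BooleanAlgebra B
      module g n = BooleanHom (g n)
      g′ : Carrier → B.Carrier
      g′ (n , a) = ⟦ g n ⟧ a
      g-lift = glue-lift B.setoid g′ (g.⟦⟧-cong _) g-suc

    copair : BooleanHom colimit B
    copair = record
      { ⟦_⟧ = g′
      ; isLatticeHomomorphism = record
        { isRelHomomorphism = record
          { cong = glue-cong B.setoid g′ (g.⟦⟧-cong _) g-suc }
        ; ∧-homo = λ (m , a) (n , b) → B.trans (g.∧-homo _ _ _)
            (B.sym (B.∧-cong (g-lift (m≤m⊔n m n) a) (g-lift (m≤n⊔m m n) b)))
        ; ∨-homo = λ (m , a) (n , b) → B.trans (g.∨-homo _ _ _)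
            (B.sym (B.∨-cong (g-lift (m≤m⊔n m n) a) (g-lift (m≤n⊔m m n) b)))
        }
      ; ¬-homo = λ (n , a) → g.¬-homo n a
      ; ⊤-homo = g.⊤-homo zero
      ; ⊥-homo = g.⊥-homo zero
      }

    -- Equality of images can be tested at a common stage, where that stage's own map is injective.
    copair-injective : (∀ n → Injective (_≈_ {n}) B._≈_ ⟦ g n ⟧) → Injective _∼_ B._≈_ ⟦ copair ⟧
    copair-injective inj {m , a} {n , b} eq =
      ∼-intro (p , refl) (q , refl)
        (inj _ (B.trans (B.sym (g-lift p a)) (B.trans eq (g-lift q b))))
      where
      p = m≤m⊔n m n
      q = m≤n⊔m m n

-- From a quantifier-free fragment to the stratified doctrine of its layers.

restrict : {C : CartesianCategory o h e} (P : BooleanDoctrine C c c) →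
           Subfunctor C P c → BooleanDoctrine C c c
restrict P S = record
  { F₀     = λ X → subalgebra (Functor.F₀ P X) (isSubalgebra X)
  ; F₁     = λ f → restrictHom (isSubalgebra _) (isSubalgebra _) (Functor.F₁ P f) (reindex f)
  ; F-cong = λ f≈g (α , _) → Functor.F-cong P f≈g α
  ; F-id   = λ (α , _) → Functor.F-id P α
  ; F-∘    = λ f g (α , _) → Functor.F-∘ P f g α
  }
  where
  open Subfunctor S

module Layers (𝐏 : QFFObject o h e r) where
  open QFFObject 𝐏
  open CartesianCategory base using (_⇒_; id; _⊗_; _⊗₁_; pr₁; module Prod)
  open Doctrine {C = base} P
  open IsFirstOrder isFirstOrder

  Layer : ℕ → ∀ X → Pred ∣ X ∣ _
  Layer = layer {c = r} base P isFirstOrder Member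

  layer-isSubalgebra : ∀ n X → IsSubalgebra (Functor.F₀ P X) (Layer n X)
  layer-isSubalgebra zero      = isSubalgebra
  layer-isSubalgebra (suc n) X = Generated-isSubalgebra (Functor.F₀ P X) _

  all-cong : ∀ {X Y β β′} → At._≈_ (X ⊗ Y) β β′ → At._≈_ X (all X Y β) (all X Y β′)
  all-cong {X} {Y} = PosetHomomorphism.cong (forallHom X Y)

  all-layer : ∀ n {X Y β} → Layer n (X ⊗ Y) β → Layer (suc n) X (all X Y β)
  all-layer n {X} {Y} {β} m = incl (Y , β , m , At.refl X)

  -- Induction on `n`, and on the generation of each layer. It is applied with preimages in
  -- `layer-map` and with images of stages in `layer⇒ins`.
  layer-least : (T : ℕ → ∀ X → Pred ∣ X ∣ ℓ′) →
                (∀ n X → IsSubalgebra (Functor.F₀ P X) (T n X)) →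
                (∀ {X α} → Member X α → T zero X α) →
                (∀ n {X Y β} → T n (X ⊗ Y) β → T (suc n) X (all X Y β)) →
                ∀ n {X α} → Layer n X α → T n X α
  layer-least T sub base all-T zero    m = base m
  layer-least T sub base all-T (suc n) {X} = Generated-least (Functor.F₀ P X) (sub (suc n) X)
    λ (Y , β , m , α≈) → IsSubalgebra.resp (sub (suc n) X) (At.sym X α≈)
                           (all-T n (layer-least T sub base all-T n m))

  -- The preimage of a layer under reindexing is a subalgebra, so generators suffice; on them
  -- Beck-Chevalley moves the reindexing under the quantifier, to the layer below.
  layer-reindex : ∀ n {X Y} (f : X ⇒ Y) {α} → Layer n Y α → Layer n X (α [ f ])
  layer-reindex zero    f = reindex f
  layer-reindex (suc n) {X} {Y} f = Generated-least (Functor.F₀ P Y)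
    (preimage-isSubalgebra (Functor.F₁ P f) (layer-isSubalgebra (suc n) X))
    λ (Z , β , m , α≈) → incl (Z , β [ f ⊗₁ id ] , layer-reindex n (f ⊗₁ id) m ,
      At.trans X (BooleanHom.⟦⟧-cong (Functor.F₁ P f) α≈) (beckChevalley f Z β))

  -- Reindexing along the diagonal is a left inverse of reindexing along pr₁ : X ⊗ X → X,
  -- so no terminal object is needed to see an element of P X as a universal quantification.
  all-pr₁ : ∀ {X} (α : ∣ X ∣) → At._≈_ X (all X X (α [ pr₁ ])) α
  all-pr₁ {X} α = X.antisym all≤ (proj₁ (adjoint X X) XX.refl)
    where
    module X  = Poset (poset (Functor.F₀ P X))
    module XX = Poset (poset (Functor.F₀ P (X ⊗ X)))
    diag : X ⇒ X ⊗ X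
    diag = Prod.⟨ id , id ⟩
    section : ∀ β → At._≈_ X ((β [ pr₁ ]) [ diag ]) β
    section β = At.trans X (At.sym X (Functor.F-∘ P diag pr₁ β))
      (At.trans X (Functor.F-cong P (Prod.project₁ id id) β) (Functor.F-id P β))
    all≤ : all X X (α [ pr₁ ]) X.≤ α
    all≤ = X.≤-respˡ-≈ (section _) (X.≤-respʳ-≈ (section _)
      (hom-mono (Functor.F₁ P diag) (proj₂ (adjoint X X) X.refl)))

  layer-suc : ∀ n {X α} → Layer n X α → Layer (suc n) X α
  layer-suc n {X} {α} m =
    incl (X , α [ pr₁ ] , layer-reindex n pr₁ m , At.sym X (all-pr₁ α))

  layerSubfunctor : ℕ → Subfunctor base P _
  layerSubfunctor n = record
    { Member       = Layer n
    ; isSubalgebra = layer-isSubalgebra n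
    ; reindex      = layer-reindex n
    }

  layerDoctrine : ℕ → BooleanDoctrine base _ _
  layerDoctrine n = restrict {C = base} P (layerSubfunctor n)

  layerInclusion : ∀ n → NatTrans (layerDoctrine n) (layerDoctrine (suc n))
  layerInclusion n = record
    { η       = λ X → restrictHom (layer-isSubalgebra n X) (layer-isSubalgebra (suc n) X)
                        (Category.id (BA _ _)) (layer-suc n)
    ; natural = λ {_} {X} _ _ → At.refl X
    }

  -- A membership proof is itself a derivation from the generators, and each of its subderivations
  -- names an element of the layer. It can therefore be replayed inside the subalgebra.
  layer-generated : ∀ n X (x : Σ ∣ X ∣ (Layer (suc n) X)) →
    Generated (Functor.F₀ (layerDoctrine (suc n)) X)
      (λ γ → ∃[ Y ] Σ[ β ∈ Σ ∣ X ⊗ Y ∣ (Layer n (X ⊗ Y)) ]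
               At._≈_ X (proj₁ γ) (all X Y (proj₁ β))) x
  layer-generated n X (α , m) = go m
    where
    go : ∀ {α} (m : Layer (suc n) X α) → Generated (Functor.F₀ (layerDoctrine (suc n)) X) _ (α , m)
    go (incl (Y , β , m , α≈)) = incl (Y , (β , m) , α≈)
    go (resp α≈ m) = resp α≈ (go m)
    go (m ∨ᵍ m′)   = go m ∨ᵍ go m′
    go (m ∧ᵍ m′)   = go m ∧ᵍ go m′
    go (¬ᵍ m)      = ¬ᵍ go m
    go ⊤ᵍ          = ⊤ᵍ
    go ⊥ᵍ          = ⊥ᵍ

  stratified : QAObject o h e r
  stratified = record
    { base = base
    ; P    = layerDoctrine
    ; i    = layerInclusion
    ; step = λ n → record
      { injective     = λ X eq → eq
      ; all           = λ X Y (β , m) → all X Y β , all-layer n m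
      ; adjoint       = λ X Y β α → mk⇔ (proj₂ (adjoint X Y)) (proj₁ (adjoint X Y))
      ; beckChevalley = λ f Y (β , _) → beckChevalley f Y β
      ; generated     = layer-generated n
      }
    -- Both sides have the same underlying element, the quantifier of `P` applied to `β`.
    ; compatible = λ n X Y β → At.refl X
    }

module LayersMap {𝐏 𝐑 : QFFObject o h e r} (𝐟 : QFFMorphism 𝐏 𝐑) where
  private
    module 𝐏  = QFFObject 𝐏
    module 𝐑  = QFFObject 𝐑
    module LP = Layers 𝐏
    module LR = Layers 𝐑
    open QFFMorphism 𝐟
    module M = Functor M
    module 𝔪 = NatTrans 𝔪
    module R = Doctrine {C = 𝐑.base} 𝐑.P

  -- Preimages of layers are subalgebras. Quantifiers are preserved up to reindexing along `θ`,
  -- under which layers are stable.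
  layer-map : ∀ n {X α} → LP.Layer n X α → LR.Layer n (M.F₀ X) (⟦ 𝔪.η X ⟧ α)
  layer-map = LP.layer-least (λ n X α → LR.Layer n (M.F₀ X) (⟦ 𝔪.η X ⟧ α))
    (λ n X → preimage-isSubalgebra (𝔪.η X) (LR.layer-isSubalgebra n (M.F₀ X)))
    (λ {X} → restricts X)
    (λ n {X} {Y} {β} m → IsSubalgebra.resp (LR.layer-isSubalgebra (suc n) (M.F₀ X))
      (R.At.sym (M.F₀ X) (all-homo X Y β))
      (LR.all-layer n (LR.layer-reindex n (θ 𝐏.base 𝐑.base preserves X Y) m)))

  stratifiedMap : QAMorphism LP.stratified LR.stratified
  stratifiedMap = record
    { M         = M
    ; preserves = preserves
    ; 𝔪         = λ n → record
      { η       = λ X → restrictHom (LP.layer-isSubalgebra n X)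
                          (LR.layer-isSubalgebra n (M.F₀ X)) (𝔪.η X) (layer-map n)
      ; natural = λ f (α , _) → 𝔪.natural f α
      }
    ; i-homo    = λ n X α → R.At.refl (M.F₀ X)
    ; all-homo  = λ n X Y (β , _) → all-homo X Y β
    }

stratify : (o h e r : Level) → Functor (QFF o h e r) (QA o h e r)
stratify o h e r = record
  { F₀     = Layers.stratified
  ; F₁     = LayersMap.stratifiedMap
  ; F-cong = λ (eq , q) → eq , λ n X (α , _) → q X α
  -- Equality of morphisms inserts a reindexing along `coe`, here an identity arrow, which
  -- functoriality of the doctrine removes.
  ; F-id   = λ {𝐏} → ≡F-refl _ , λ n X (α , _) →
      BooleanAlgebra.sym (Functor.F₀ (QFFObject.P 𝐏) X) (Functor.F-id (QFFObject.P 𝐏) α)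
  ; F-∘    = λ {_} {_} {𝐑} 𝐠 𝐟 → ≡F-refl _ , λ n X (α , _) →
      BooleanAlgebra.sym (Functor.F₀ (QFFObject.P 𝐑) _) (Functor.F-id (QFFObject.P 𝐑) _)
  }

-- From a stratified doctrine to the first-order doctrine on its colimit.

module Union (𝐏 : QAObject o h e r) where
  open QAObject 𝐏
  open CartesianCategory base using (_⊗_; pr₁)

  module Colim X = Colimit (λ n → Functor.F₀ (P n) X) (λ n → i.η n X) (λ n → step.injective n X)

  unionDoctrine : BooleanDoctrine base _ _
  unionDoctrine = record
    { F₀     = Colim.colimit
    ; F₁     = λ {X} {Y} f → Colim.copair X
        (λ n → Category._∘_ (BA _ _) (Colim.ins Y n) (Functor.F₁ (P n) f))
        (λ n α → Colim.∼-trans Y (Colim.ins-suc Y _)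
          (Colim.ins-cong Y (i.natural n f α)))
    ; F-cong = λ {X} {Y} f≈g (n , α) → Colim.ins-cong Y (Functor.F-cong (P n) f≈g α)
    ; F-id   = λ {X} (n , α) → Colim.ins-cong X (Functor.F-id (P n) α)
    ; F-∘    = λ {_} {_} {Z} f g (n , α) → Colim.ins-cong Z (Functor.F-∘ (P n) f g α)
    }

  open Doctrine {C = base} unionDoctrine

  all : ∀ X Y → ∣ X ⊗ Y ∣ → ∣ X ∣
  all X Y (n , β) = suc n , step.all n X Y β

  -- Compatibility of consecutive one-step quantifiers is exactly the cocone condition for gluing
  -- them.
  all-cong : ∀ X Y {x y} → At._≈_ (X ⊗ Y) x y → At._≈_ X (all X Y x) (all X Y y)
  all-cong X Y = Colim.glue-cong (X ⊗ Y) (At.setoid X) (all X Y)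
    (λ {n} β≈β′ → Colim.ins-cong X (step.all-cong n X Y β≈β′))
    (λ n β → Colim.∼-trans X (Colim.ins-suc X _) (Colim.ins-cong X (compatible n X Y β)))

  -- Both elements are first brought to stage `k`. The quantifier of `b` lies one stage higher, so
  -- `a` is pushed to `suc k`, and the one-step adjunction at `k` compares everything there.
  all-adjoint : ∀ X Y → Adjoint (At._≤_ X) (At._≤_ (X ⊗ Y)) (_[ pr₁ ]) (all X Y)
  all-adjoint X Y {x} {y} =
    (λ x[]≤y → X.≤-respˡ-≈ (At.sym X x≈) (X.≤-respʳ-≈ (At.sym X all≈)
      (hom-mono (Colim.ins X (suc k)) (Iff.from (step.adjoint k X Y b (⟦ i.η k X ⟧ a))
        (hom-cancel-≤ (Colim.ins (X ⊗ Y) (suc k)) (Colim.ins-injective (X ⊗ Y))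
          (XY.≤-respˡ-≈ x[]≈ (XY.≤-respʳ-≈ y≈ x[]≤y)))))))
    , λ x≤all → XY.≤-respˡ-≈ (At.sym (X ⊗ Y) x[]≈) (XY.≤-respʳ-≈ (At.sym (X ⊗ Y) y≈)
      (hom-mono (Colim.ins (X ⊗ Y) (suc k)) (Iff.to (step.adjoint k X Y b (⟦ i.η k X ⟧ a))
        (hom-cancel-≤ (Colim.ins X (suc k)) (Colim.ins-injective X)
          (X.≤-respˡ-≈ x≈ (X.≤-respʳ-≈ all≈ x≤all))))))
    where
    module X  = Poset (poset (Functor.F₀ unionDoctrine X))
    module XY = Poset (poset (Functor.F₀ unionDoctrine (X ⊗ Y)))
    m = proj₁ x
    n = proj₁ y
    k = m ⊔ℕ n
    a = ⟦ Colim.lift X (m≤m⊔n m n) ⟧ (proj₂ x)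
    b = ⟦ Colim.lift (X ⊗ Y) (m≤n⊔m m n) ⟧ (proj₂ y)
    x≈ : At._≈_ X x (suc k , ⟦ i.η k X ⟧ a)
    x≈ = At.trans X (Colim.∼-lift X (m≤m⊔n m n)) (Colim.ins-suc X a)
    x[]≈ : At._≈_ (X ⊗ Y) (x [ pr₁ ]) ((suc k , ⟦ i.η k X ⟧ a) [ pr₁ ])
    x[]≈ = BooleanHom.⟦⟧-cong (Functor.F₁ unionDoctrine pr₁) x≈
    y≈′ : At._≈_ (X ⊗ Y) y (k , b)
    y≈′ = Colim.∼-lift (X ⊗ Y) (m≤n⊔m m n)
    y≈ : At._≈_ (X ⊗ Y) y (suc k , ⟦ i.η k (X ⊗ Y) ⟧ b)
    y≈ = At.trans (X ⊗ Y) y≈′ (Colim.ins-suc (X ⊗ Y) b)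
    all≈ : At._≈_ X (all X Y y) (suc k , step.all k X Y b)
    all≈ = all-cong X Y y≈′

  unionDoctrine-isFirstOrder : IsFirstOrder base unionDoctrine
  unionDoctrine-isFirstOrder = record
    { forallHom = λ X Y →
        let module X  = Poset (poset (Functor.F₀ unionDoctrine X))
            module XY = Poset (poset (Functor.F₀ unionDoctrine (X ⊗ Y)))
        in record
        { ⟦_⟧ = all X Y
        ; isOrderHomomorphism = record
          { cong = all-cong X Y
          -- Transpose the counit of the adjunction followed by `x≤y`.
          ; mono = λ x≤y → proj₁ (all-adjoint X Y)
                             (XY.trans (proj₂ (all-adjoint X Y) X.refl) x≤y)
          }
        }
    ; adjoint       = all-adjoint
    ; beckChevalley = λ {X} {X′} f Y (n , β) →
        Colim.ins-cong X′ (step.beckChevalley n f Y β)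
    }

  -- Membership is up to `∼`, since an element presented at a higher stage may still equal one from
  -- stage zero.
  fragment : Subfunctor base unionDoctrine _
  fragment = record
    { Member       = λ X x → ∃[ α ] At._≈_ X x (zero , α)
    ; isSubalgebra = λ X → image-isSubalgebra (Colim.ins X zero)
    ; reindex      = λ f (α , x≈α) → _ , BooleanHom.⟦⟧-cong (Functor.F₁ unionDoctrine f) x≈α
    }

  fragmentLayer : ℕ → ∀ X → Pred ∣ X ∣ _
  fragmentLayer =
    layer {c = r} base unionDoctrine unionDoctrine-isFirstOrder (Subfunctor.Member fragment)

  -- Elements landing in the layer form a subalgebra, so by `generated` only quantified elements
  -- need checking, and their bodies are handled by induction.
  ins-layer : ∀ n {X} (α : P.∣_∣ n X) → fragmentLayer n X (n , α)
  ins-layer zero    {X} α = α , At.refl X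
  ins-layer (suc n) {X} α = Generated-least (Functor.F₀ (P (suc n)) X)
    (preimage-isSubalgebra (Colim.ins X (suc n))
      (Generated-isSubalgebra (Functor.F₀ unionDoctrine X) _))
    (λ (Y , β , γ≈) → incl (Y , (n , β) , ins-layer n β , Colim.ins-cong X γ≈))
    (step.generated n X α)

  firstOrder : QFFObject o h e r
  firstOrder = record
    { base         = base
    ; P            = unionDoctrine
    ; isFirstOrder = unionDoctrine-isFirstOrder
    ; P₀           = fragment
    ; isQFF        = record { exhausts = λ X (n , α) → n , ins-layer n α }
    }

  -- The images of the stages are subalgebras, start with the fragment, and the quantifier carries
  -- each into the next. With `ins-layer` this identifies stage `n` with layer `n`.
  layer⇒ins : ∀ n {X x} → fragmentLayer n X x → ∃[ α ] At._≈_ X x (n , α)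
  layer⇒ins = Layers.layer-least firstOrder (λ n X x → ∃[ α ] At._≈_ X x (n , α))
    (λ n X → image-isSubalgebra (Colim.ins X n))
    (λ m → m)
    (λ n {X} {Y} (β , x≈β) → step.all n X Y β , all-cong X Y x≈β)

module UnionMap {𝐏 𝐑 : QAObject o h e r} (𝐟 : QAMorphism 𝐏 𝐑) where
  private
    module 𝐑  = QAObject 𝐑
    module LP = Union 𝐏
    module LR = Union 𝐑
    open QAMorphism 𝐟

  colimitMap : ∀ X → BooleanHom (LP.Colim.colimit X) (LR.Colim.colimit (M.F₀ X))
  colimitMap X = LP.Colim.copair X
    (λ n → Category._∘_ (BA _ _) (LR.Colim.ins (M.F₀ X) n) (𝔪.η n X))
    (λ n α → LR.Colim.∼-trans (M.F₀ X) (LR.Colim.ins-suc (M.F₀ X) _)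
      (LR.Colim.ins-cong (M.F₀ X) (𝐑.P.At.sym (suc n) (M.F₀ X) (i-homo n X α))))

  firstOrderMap : QFFMorphism LP.firstOrder LR.firstOrder
  firstOrderMap = record
    { morphism = record
      { M         = M
      ; preserves = preserves
      ; 𝔪         = record
        { η       = colimitMap
        ; natural = λ {_} {Y} f (n , α) → LR.Colim.ins-cong (M.F₀ Y) (𝔪.natural n f α)
        }
      }
    ; isFirstOrder = record
      { all-homo = λ X Y (n , β) → LR.Colim.ins-cong (M.F₀ X) (all-homo n X Y β) }
    ; restricts = λ X (α , x≈α) → ⟦ 𝔪.η zero X ⟧ α , BooleanHom.⟦⟧-cong (colimitMap X) x≈α
    }

union : (o h e r : Level) → Functor (QA o h e r) (QFF o h e r)
union o h e r = record
  { F₀     = Union.firstOrder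
  ; F₁     = UnionMap.firstOrderMap
  ; F-cong = λ {_} {𝐑} {𝐟} (eq , q) → eq , λ X (n , α) →
      Union.Colim.ins-cong 𝐑 (Functor.F₀ (QAMorphism.M 𝐟) X) (q n X α)
  ; F-id   = λ {𝐏} → ≡F-refl _ , λ X x →
      BooleanAlgebra.sym (Functor.F₀ (Union.unionDoctrine 𝐏) X)
        (Functor.F-id (Union.unionDoctrine 𝐏) x)
  ; F-∘    = λ {_} {_} {𝐑} 𝐠 𝐟 → ≡F-refl _ , λ X x →
      BooleanAlgebra.sym (Functor.F₀ (Union.unionDoctrine 𝐑) _)
        (Functor.F-id (Union.unionDoctrine 𝐑) _)
  }

-- A first-order doctrine compared with the colimit of its layers.

module Collapse {o h e r : Level} (𝐏 : QFFObject o h e r) where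
  open QFFObject 𝐏
  open CartesianCategory base using (category)
  private
    module L   = Layers 𝐏
    module U   = Union (Functor.F₀ (stratify o h e r) 𝐏)
    module P   = Doctrine {C = base} P
    module P∞  = Doctrine {C = base} U.unionDoctrine

  collapse : ∀ X → BooleanHom (Functor.F₀ U.unionDoctrine X) (Functor.F₀ P X)
  collapse X = U.Colim.copair X (λ n → inclusionHom (L.layer-isSubalgebra n X))
    (λ n α → P.At.refl X)

  collapse-injective : ∀ X → Injective (P∞.At._≈_ X) (P.At._≈_ X) ⟦ collapse X ⟧
  collapse-injective X = U.Colim.copair-injective X
    (λ n → inclusionHom (L.layer-isSubalgebra n X)) (λ n α → P.At.refl X) (λ n eq → eq)

  -- The stage is whichever one exhaustion supplies, not necessarily the least. Since `collapse` is
  -- injective, different choices give equal elements of the colimit.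
  firstStage : ∀ X → P.∣ X ∣ → P∞.∣ X ∣
  firstStage X α = let n , m = IsQuantifierFreeFragment.exhausts isQFF X α in n , α , m

  expand : ∀ X → BooleanHom (Functor.F₀ P X) (Functor.F₀ U.unionDoctrine X)
  expand X = inverseHom (collapse X) (collapse-injective X) (firstStage X) (λ α → P.At.refl X)

  collapseMorphism : QFFMorphism (Functor.F₀ (union o h e r ∘F stratify o h e r) 𝐏) 𝐏
  collapseMorphism = record
    { morphism = record
      { M         = idF category
      ; preserves = id-preserves category
      ; 𝔪         = record
        { η       = collapse
        ; natural = λ {_} {Y} f x → P.At.refl Y
        }
      }
    ; isFirstOrder = record
      -- Over the identity functor, the product comparison `θ` reindexes trivially.
      { all-homo = λ X Y (n , (β , _)) → L.all-cong (θ-id {C = base} P X Y β) }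
    ; restricts = λ X ((α , m) , x≈α) → IsSubalgebra.resp (isSubalgebra X)
        (P.At.sym X (BooleanHom.⟦⟧-cong (collapse X) x≈α)) m
    }

  expandMorphism : QFFMorphism 𝐏 (Functor.F₀ (union o h e r ∘F stratify o h e r) 𝐏)
  expandMorphism = record
    { morphism = record
      { M         = idF category
      ; preserves = id-preserves category
      ; 𝔪         = record
        { η       = expand
        -- The two sides may sit at different stages, but they collapse to the same element of `P`.
        ; natural = λ {_} {Y} f α → collapse-injective Y (P.At.refl Y)
        }
      }
    ; isFirstOrder = record
      { all-homo = λ X Y β → collapse-injective X (L.all-cong (θ-id {C = base} P X Y β)) }
    ; restricts = λ X {α} m → (α , m) , collapse-injective X (P.At.refl X)
    }

-- The stages of a stratified doctrine compared with the layers of its colimit.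

module Embed {o h e r : Level} (𝐏 : QAObject o h e r) where
  open QAObject 𝐏
  open CartesianCategory base using (category; _⊗_)
  private
    module U   = Union 𝐏
    module L   = Layers (Functor.F₀ (union o h e r) 𝐏)
    module P∞  = Doctrine {C = base} U.unionDoctrine

  embed : ∀ n X → BooleanHom (Functor.F₀ (P n) X) (Functor.F₀ (L.layerDoctrine n) X)
  embed n X = corestrictHom (L.layer-isSubalgebra n X) (U.Colim.ins X n) (U.ins-layer n)

  representative : ∀ n X → Σ P∞.∣ X ∣ (L.Layer n X) → P.∣_∣ n X
  representative n X (x , m) = proj₁ (U.layer⇒ins n m)

  embed∘representative : ∀ n X ((x , m) : Σ P∞.∣ X ∣ (L.Layer n X)) →
                         P∞.At._≈_ X (n , representative n X (x , m)) x
  embed∘representative n X (x , m) = P∞.At.sym X (proj₂ (U.layer⇒ins n m))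

  project : ∀ n X → BooleanHom (Functor.F₀ (L.layerDoctrine n) X) (Functor.F₀ (P n) X)
  project n X = inverseHom (embed n X) (U.Colim.ins-injective X)
    (representative n X) (embed∘representative n X)

  embedMorphism : QAMorphism 𝐏 (Functor.F₀ (stratify o h e r ∘F union o h e r) 𝐏)
  embedMorphism = record
    { M         = idF category
    ; preserves = id-preserves category
    ; 𝔪         = λ n → record
      { η       = embed n
      ; natural = λ {_} {Y} f α → P∞.At.refl Y
      }
    ; i-homo    = λ n X α → P∞.At.sym X (U.Colim.ins-suc X α)
    ; all-homo  = λ n X Y β →
        U.Colim.ins-cong X (step.all-cong n X Y (θ-id {C = base} (P n) X Y β))
    }

  -- Each law is checked in the colimit, into which the stages inject and where a representative
  -- equals the element it represents.
  projectMorphism : QAMorphism (Functor.F₀ (stratify o h e r ∘F union o h e r) 𝐏) 𝐏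
  projectMorphism = record
    { M         = idF category
    ; preserves = id-preserves category
    ; 𝔪         = λ n → record
      { η       = project n
      ; natural = λ {X} {Y} f x → U.Colim.ins-injective Y
          (P∞.At.trans Y (embed∘representative n Y (⟦ Functor.F₁ (L.layerDoctrine n) f ⟧ x))
            (P∞.At.sym Y (BooleanHom.⟦⟧-cong (Functor.F₁ U.unionDoctrine f)
              (embed∘representative n X x))))
      }
    ; i-homo    = λ n X x → U.Colim.ins-injective X
        (P∞.At.trans X (embed∘representative (suc n) X (⟦ NatTrans.η (L.layerInclusion n) X ⟧ x))
          (P∞.At.trans X (P∞.At.sym X (embed∘representative n X x)) (U.Colim.ins-suc X _)))
    ; all-homo  = λ n X Y x → U.Colim.ins-injective X
        (P∞.At.trans X (embed∘representative (suc n) X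
            (IsQAOneStep.all (QAObject.step L.stratified n) X Y x))
          (P∞.At.trans X (P∞.At.sym X (U.all-cong X Y (embed∘representative n (X ⊗ Y) x)))
            (U.Colim.ins-cong X (step.all-cong n X Y (θ-id {C = base} (P n) X Y _)))))
    }

-- Natural isomorphisms and the equivalence.

module _ {o′ h′ e′ : Level} {C : Category o h e} {D : Category o′ h′ e′} {F G : Functor C D}
         (τ : NatTrans G F) where
  private
    module D = Category D
    module F = Functor F
    module G = Functor G
    module τ = NatTrans τ

  -- Naturality of `σ` follows by inserting `τ ∘ σ`, using naturality of `τ`, and cancelling
  -- `σ ∘ τ`. So naturality is checked directly only for collapsing and embedding, which involve no
  -- choice of representatives.
  pointwiseInverse : (σ : ∀ X → F.F₀ X D.⇒ G.F₀ X) →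
                     (∀ X → σ X D.∘ τ.η X D.≈ D.id) → (∀ X → τ.η X D.∘ σ X D.≈ D.id) →
                     NatIso F G
  pointwiseInverse σ σ∘τ τ∘σ = record
    { to      = record { η = σ ; natural = σ-natural }
    ; from    = τ
    ; from∘to = τ∘σ
    ; to∘from = σ∘τ
    }
    where
    open D.Equiv
    σ-natural : ∀ {X Y} f → σ Y D.∘ F.F₁ f D.≈ G.F₁ {X} {Y} f D.∘ σ X
    σ-natural {X} {Y} f =
      trans (D.∘-cong refl (trans (sym (D.identityʳ _))
              (trans (D.∘-cong refl (sym (τ∘σ X))) (sym (D.assoc _ _ _)))))
        (trans (D.∘-cong refl (trans (D.∘-cong (sym (τ.natural f)) refl) (D.assoc _ _ _)))
          (trans (sym (D.assoc _ _ _))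
            (trans (D.∘-cong (σ∘τ Y) refl) (D.identityˡ _))))

unit : (o h e r : Level) → NatIso (idF (QFF o h e r)) (union o h e r ∘F stratify o h e r)
unit o h e r = pointwiseInverse
  {F = idF (QFF o h e r)} {G = union o h e r ∘F stratify o h e r}
  (record
    { η       = Collapse.collapseMorphism
    ; natural = λ {_} {𝐑} 𝐟 →
        record { obj≡ = λ _ → ≡.refl ; hom≈ = λ _ → id-commutes (category 𝐑) _ } ,
        λ _ _ → sym (Functor.F₀ (P 𝐑) _) (Functor.F-id (P 𝐑) _)
    })
  Collapse.expandMorphism
  (λ 𝐏 →
    record { obj≡ = λ _ → ≡.refl ; hom≈ = λ _ → id-commutes (category 𝐏) _ } ,
    -- Collapsing and then expanding may change the stage, so the equation is verified after
    -- collapsing.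
    λ X x → Collapse.collapse-injective 𝐏 X
      (sym (Functor.F₀ (P 𝐏) X) (Functor.F-id (P 𝐏) _)))
  (λ 𝐏 →
    record { obj≡ = λ _ → ≡.refl ; hom≈ = λ _ → id-commutes (category 𝐏) _ } ,
    λ X α → sym (Functor.F₀ (P 𝐏) X) (Functor.F-id (P 𝐏) α))
  where
  open QFFObject using (base; P)
  open BooleanAlgebra using (sym)
  category : (𝐏 : QFFObject o h e r) → Category o h e
  category 𝐏 = CartesianCategory.category (base 𝐏)

counit : (o h e r : Level) → NatIso (stratify o h e r ∘F union o h e r) (idF (QA o h e r))
counit o h e r = pointwiseInverse
  {F = stratify o h e r ∘F union o h e r} {G = idF (QA o h e r)}
  (record
    { η       = Embed.embedMorphism
    ; natural = λ {_} {𝐑} 𝐟 →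
        record { obj≡ = λ _ → ≡.refl ; hom≈ = λ _ → id-commutes (category 𝐑) _ } ,
        λ _ _ _ → sym (P∞ 𝐑 _) (Functor.F-id (Union.unionDoctrine 𝐑) _)
    })
  Embed.projectMorphism
  (λ 𝐏 →
    record { obj≡ = λ _ → ≡.refl ; hom≈ = λ _ → id-commutes (category 𝐏) _ } ,
    λ n X α → Union.Colim.ins-injective 𝐏 X
      (trans (P∞ 𝐏 X) (Embed.embed∘representative 𝐏 n X (⟦ Embed.embed 𝐏 n X ⟧ α))
        (sym (P∞ 𝐏 X) (Functor.F-id (Union.unionDoctrine 𝐏) _))))
  (λ 𝐏 →
    record { obj≡ = λ _ → ≡.refl ; hom≈ = λ _ → id-commutes (category 𝐏) _ } ,
    λ n X x → trans (P∞ 𝐏 X) (Embed.embed∘representative 𝐏 n X x)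
      (sym (P∞ 𝐏 X) (Functor.F-id (Union.unionDoctrine 𝐏) _)))
  where
  open QAObject using (base)
  open BooleanAlgebra using (sym; trans)
  category : (𝐏 : QAObject o h e r) → Category o h e
  category 𝐏 = CartesianCategory.category (base 𝐏)
  P∞ : (𝐏 : QAObject o h e r) → CartesianCategory.Obj (base 𝐏) → BooleanAlgebra _ _
  P∞ 𝐏 = Functor.F₀ (Union.unionDoctrine 𝐏)

proposition3p17 : (o h e r : Level) → CategoryEquivalence (QFF o h e r) (QA o h e r)
proposition3p17 o h e r = record
  { F      = stratify o h e r
  ; G      = union o h e r
  ; unit   = unit o h e r
  ; counit = counit o h e r
  }
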